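{- Let $p$ be an odd prime and let $c$ be an integer. Let $D_p(c)=\left[(i^2+cij+j^2)^{p-2}\right]_{1\le i,j\le p-1}$. Then the following hold. (1) If $c\equiv\pm2\pmod{p}$, then $p\mid\det D_p(c)$. (2) If $\left(\frac{c^2-4}{p}\right)=1$, then there exists $x\in\mathbb{Z}$ such that $$\det D_p(c)\equiv x^2\left(\frac{ -c-2}{p}\right)\pmod{p}.$$ (3) If $\left(\frac{c^2-4}{p}\right)=-1$, then there exists $x\in\mathbb{Z}$ such that $$\det D_p(c)\equiv 2cx^2\left(\frac{ -c-2}{p}\right)\pmod{p}.$$
   Context: $\left(\frac{\cdot}{p}\right)$ denotes the Legendre symbol modulo the odd prime $p$ (with value $0$ on multiples of $p$). $D_p(c)$ is the $(p-1)\times(p-1)$ integer matrix whose $(i,j)$ entry is $(i^2+cij+j^2)^{p-2}$, $1\le i,j\le p-1$.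
   Formalization: Part (1) is stated only for p ≠ 3, because it is false at p = 3: for c = 1 the determinant is -13 and for c = 2 it is -17, so it fails for every c ≡ ±2 (mod 3). Parts (2) and (3) are stated for all odd primes. -}

module Defs where

import Algebra.Properties.CommutativeMonoid.Sum
open import Data.Bool using (if_then_else_)
open import Data.Fin using (Fin; zero; suc; toℕ; punchIn)
open import Data.Fin.Properties using (any?)
open import Data.Integer using (ℤ; +_; _+_; _-_; _*_; _^_; 0ℤ; 1ℤ; -1ℤ)
open import Data.Integer.Divisibility.Signed using (_∣_; _∣?_)
open import Data.Integer.Properties using (+-0-commutativeMonoid)
open import Data.Nat using (ℕ; _∸_)
open import Relation.Nullary using (Dec; does; ¬_)
open import Relation.Nullary.Decidable using (from-no)

open Algebra.Properties.CommutativeMonoid.Sum +-0-commutativeMonoid using (sum-syntax)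

infix 4 _≡_[mod_] _≡?_[mod_]

_≡_[mod_] : ℤ → ℤ → ℕ → Set
a ≡ b [mod m ] = + m ∣ a - b

_≡?_[mod_] : ∀ a b m → Dec (a ≡ b [mod m ])
a ≡? b [mod m ] = + m ∣? a - b

-- The Legendre symbol (a/p). The existence of a square root of a modulo p is
-- decided by searching the complete residue system 0, 1, …, p - 1.
legendre : ℤ → ℕ → ℤ
legendre a p =
  if does (a ≡? 0ℤ [mod p ]) then 0ℤ
  else if does (any? {n = p} λ x → (+ toℕ x) ^ 2 ≡? a [mod p ]) then 1ℤ
  else -1ℤ

Matrix : ℕ → Set
Matrix n = Fin n → Fin n → ℤ

-- Laplace expansion along the first row; punchIn j enumerates, in order, the
-- column indices other than j.
det : ∀ {n} → Matrix n → ℤ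
det {ℕ.zero}  A = 1ℤ
det {ℕ.suc n} A =
  ∑[ j < ℕ.suc n ] (-1ℤ ^ toℕ j * A zero j * det (λ r k → A (suc r) (punchIn j k)))

-- Fin (p ∸ 1) is indexed from 0, so the index i stands for the integer i + 1.
D : (p : ℕ) → ℤ → Matrix (p ∸ 1)
D p c i j = (x ^ 2 + c * x * y + y ^ 2) ^ (p ∸ 2)
  where
  x = + ℕ.suc (toℕ i)
  y = + ℕ.suc (toℕ j)

-- For p = 3 the determinant is prime to p when c ≡ ±2 (mod p): it is -13 for
-- c = 1 and -17 for c = 2. So p ∣ det (D p c) needs p ≢ 3 in that case.
3∤detD₁ : ¬ (+ 3 ∣ det (D 3 (+ 1)))
3∤detD₁ = from-no (+ 3 ∣? det (D 3 (+ 1)))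

3∤detD₂ : ¬ (+ 3 ∣ det (D 3 (+ 2)))
3∤detD₂ = from-no (+ 3 ∣? det (D 3 (+ 2)))

{-# OPTIONS --safe #-}

-- Modulo p, the substitution j = i t shows that D sends the character j ↦ j^(r+1) of the group of
-- nonzero residues to a multiple of i^(r-2+p): with W the (invertible) matrix of the powers j^(r+1),
-- one has D W = diag(i^(p-3)) W diag(μ₀, …, μ_{p-2}), where
--   μᵣ = ∑_{t ≠ 0} tʳ (t + t⁻¹ + c)^(p-2).
-- Replacing t by t⁻¹ gives μᵣ = μ_{p-1-r}. With m = (p-1)/2, only r = 0 and r = m are unpaired, so
-- det D is a square times μ₀ μₘ. These two are found by grouping the terms according to
-- s = t + t⁻¹, which is attained 1 + (s²-4)ᵐ times, and reading off one coefficient of the resulting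
-- polynomial in s: with k = m - 1,
--   μ₀ = - c (c²-4)ᵏ  and  μₘ = - m ((2-c)ᵏ + (-2-c)ᵏ).
module Submission where

open import Defs
import Algebra.Properties.CommutativeMonoid.Sum
open import Algebra.Bundles using (CommutativeMonoid)
open import Data.Bool using (if_then_else_)
open import Data.Fin using (Fin; zero; suc; toℕ; fromℕ<; punchIn; inject₁)
open import Data.Fin.Permutation using (Permutation; permutation)
open import Data.Fin.Properties using (toℕ-fromℕ<; toℕ-injective; toℕ-inject₁; toℕ<n; any?; _≟_)
open import Data.Integer using (ℤ; +_; -_; _+_; _-_; _*_; _^_; ∣_∣; 0ℤ; 1ℤ; -1ℤ)
open import Data.Integer.Divisibility.Signed using (_∣_; divides; ∣m⇒∣-m; ∣m∣n⇒∣m+n; ∣m⇒∣m*n; ∣n⇒∣m*n; ∣⇒∣ᵤ; ∣ᵤ⇒∣)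
open import Data.Integer.DivMod using (_%ℕ_; _/ℕ_; n%ℕd<d; a≡a%ℕn+[a/ℕn]*n)
open import Data.Integer.Properties hiding (_≟_)
open import Data.Integer.Tactic.RingSolver using (solve-∀)
open import Data.Nat as ℕ using (ℕ; z≤n; s≤s)
open import Data.Nat.Coprimality using (coprime-Bézout; prime⇒coprime)
open import Data.Nat.Divisibility using (_∤_)
import Data.Nat.Divisibility as ℕ
open import Data.Nat.GCD using (module Bézout)
open import Data.Nat.Primality using (Prime; euclidsLemma; ¬prime[1])
import Data.Nat.Properties as ℕ
import Data.Nat.Tactic.RingSolver as ℕ-Solver
open import Data.Product using (_×_; _,_; proj₁; proj₂; ∃-syntax)
open import Data.Sum as Sum using (_⊎_; inj₁; inj₂; [_,_]′)
open import Data.Unit using (⊤; tt)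
open import Data.Vec.Functional using (_∷_; head; tail; insertAt)
open import Function using (_∘_)
open import Relation.Binary using (IsEquivalence; Setoid)
open import Relation.Binary.PropositionalEquality hiding (setoid; isEquivalence)
open import Relation.Nullary using (Dec; yes; no; does; ¬_; contradiction)
open import Relation.Nullary.Decidable using (map′; dec-true; dec-false)

open import Algebra.Properties.Semiring.Sum +-*-semiring
module Prod = Algebra.Properties.CommutativeMonoid.Sum *-1-commutativeMonoid

-- The determinant is given by Laplace expansion, so the product rule behind the diagonalisation has
-- to be derived: it comes from the characterisation of `det` as the only alternating, row-linear
-- function up to its value at the identity. Modulo p, one fact does the work of reading off
-- coefficients: the sum of aʲ over all residues is -1 if j is a positive multiple of p - 1, and 0
-- otherwise. It also inverts W and counts the square roots of d as 1 + dᵐ. In μ₀ and μₘ a power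
-- u^(p-2) meets a polynomial of degree at most p - 1, so all exponents stay below 2 (p - 1) and
-- just the linear coefficient survives. The symbols come in at the end. Put a = 2 - c and b = -2 -
-- c, so that ab = c² - 4. If (ab)ᵐ = ε = ±1, then aᵐ = ε bᵐ, and up to a square μ₀ μₘ is m c (b + ε
-- a) bᵐ. Since b + a = -2c and b - a = -4, the factor c becomes part of a square in (2) but stays
-- in (3).

module Determinants where

  open ≡-Reasoning

  -- Alternating multilinear functions of rows.

  Row : ℕ → Set
  Row m = Fin m → ℤ

  Rows : ℕ → ℕ → Set
  Rows n m = Fin n → Row m

  -- The single law `axpy` covers additivity (a = 1) and, as it forces the value 0 at the zero row,
  -- homogeneity. Rows are functions and may agree pointwise without being propositionally equal,
  -- hence `respects`.
  record Linear {m} (L : Row m → ℤ) : Set where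
    field
      respects : ∀ {v w} → v ≗ w → L v ≡ L w
      axpy : ∀ v a w → L (λ j → v j + a * w j) ≡ L v + a * L w
  open Linear

  record LinearMap {m m′} (L : Row m → Row m′) : Set where
    field
      coordinate : ∀ j → Linear (λ v → L v j)
  open LinearMap

  Degenerate : ∀ n {m} → (Rows (ℕ.suc n) m → ℤ) → Set
  Degenerate ℕ.zero    F = ⊤
  Degenerate (ℕ.suc n) F = ∀ v A → F (v ∷ v ∷ A) ≡ 0ℤ

  Respects : ∀ {n m} → (Rows n m → ℤ) → Set
  Respects F = ∀ {A B} → (∀ i → A i ≗ B i) → F A ≡ F B

  record AltStep {n m} (AltRest : (Rows n m → ℤ) → Set) (F : Rows (ℕ.suc n) m → ℤ) : Set where
    field
      linear     : ∀ A → Linear (λ v → F (v ∷ A))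
      degenerate : Degenerate n F
      rest       : ∀ v → AltRest (λ A → F (v ∷ A))
  open AltStep

  -- Alternation is only required of the first two rows; fixing the first row then gives it for
  -- all pairs of consecutive rows.
  Alternating : ∀ n {m} → (Rows n m → ℤ) → Set
  Alternating ℕ.zero    F = Respects F
  Alternating (ℕ.suc n) F = Respects F × AltStep (Alternating n) F

  ∷-cong : ∀ {n m} {v w : Row m} {A B : Rows n m} →
           v ≗ w → (∀ i → A i ≗ B i) → ∀ i → (v ∷ A) i ≗ (w ∷ B) i
  ∷-cong v≗w A≗B zero    = v≗w
  ∷-cong v≗w A≗B (suc i) = A≗B i

  alt-ext : ∀ n {m} {F G : Rows n m → ℤ} → (∀ A → F A ≡ G A) → Alternating n F → Alternating n G
  alt-ext ℕ.zero    F≗G alt A≗B = trans (sym (F≗G _)) (trans (alt A≗B) (F≗G _))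
  alt-ext (ℕ.suc n) {F = F} {G} F≗G (resp-F , step-F) =
    (λ A≗B → trans (sym (F≗G _)) (trans (resp-F A≗B) (F≗G _))) , record
    { linear = λ A → record
      { respects = λ v≗w → trans (sym (F≗G _)) (trans (respects (linear step-F A) v≗w) (F≗G _))
      ; axpy = λ v a w → trans (sym (F≗G _)) (trans (axpy (linear step-F A) v a w)
                           (cong₂ (λ x y → x + a * y) (F≗G _) (F≗G _)))
      }
    ; degenerate = deg n F≗G (degenerate step-F)
    ; rest = λ v → alt-ext n (λ A → F≗G _) (rest step-F v)
    }
    where
    deg : ∀ n {m} {F G : Rows (ℕ.suc n) m → ℤ} → (∀ A → F A ≡ G A) → Degenerate n F → Degenerate n G
    deg ℕ.zero    F≗G d     = tt
    deg (ℕ.suc n) F≗G d v A = trans (sym (F≗G _)) (d v A)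

  -- Serves three maps on rows: deleting a column, inserting a zero entry, and multiplying by a
  -- fixed matrix.
  alt-∘ : ∀ n {m m′} {F : Rows n m′ → ℤ} {L : Row m → Row m′} → LinearMap L →
          Alternating n F → Alternating n (λ A → F (L ∘ A))
  alt-∘ ℕ.zero    lin alt A≗B = alt λ ()
  alt-∘ (ℕ.suc n) {F = F} {L} lin (resp-F , step-F) =
    (λ A≗B → resp-F λ i j → respects (coordinate lin j) (A≗B i)) , record
    { linear = λ A → record
      { respects = λ v≗w → resp-F λ { zero j → respects (coordinate lin j) v≗w ; (suc i) j → refl }
      ; axpy = λ v a w → begin
          F (L ∘ ((λ j → v j + a * w j) ∷ A))             ≡⟨ resp-F (λ { zero j → axpy (coordinate lin j) v a w ; (suc i) j → refl }) ⟩
          F ((λ j → L v j + a * L w j) ∷ (L ∘ A))         ≡⟨ axpy (linear step-F (L ∘ A)) (L v) a (L w) ⟩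
          F (L v ∷ (L ∘ A)) + a * F (L w ∷ (L ∘ A))       ≡⟨ cong₂ (λ x y → x + a * y) (∘-∷ v A) (∘-∷ w A) ⟩
          F (L ∘ (v ∷ A)) + a * F (L ∘ (w ∷ A))           ∎
      }
    ; degenerate = deg n resp-F (degenerate step-F)
    ; rest = λ v → alt-ext n (∘-∷ v) (alt-∘ n lin (rest step-F (L v)))
    }
    where
    ∘-∷ : ∀ v A → F (L v ∷ (L ∘ A)) ≡ F (L ∘ (v ∷ A))
    ∘-∷ v A = resp-F λ { zero j → refl ; (suc i) j → refl }
    deg : ∀ n {F : Rows (ℕ.suc n) _ → ℤ} → Respects F → Degenerate n F → Degenerate n (λ A → F (L ∘ A))
    deg ℕ.zero    _      d     = tt
    deg (ℕ.suc n) resp-F d v A =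
      trans (resp-F λ { zero j → refl ; (suc zero) j → refl ; (suc (suc i)) j → refl }) (d (L v) (L ∘ A))

  sum-zero : ∀ {n} {f : Fin n → ℤ} → (∀ i → f i ≡ 0ℤ) → sum f ≡ 0ℤ
  sum-zero {n} f≗0 = trans (sum-cong-≗ f≗0) (sum-replicate-zero n)

  sum-axpy : ∀ {n} (f : Fin n → ℤ) a g → ∑[ i < n ] (f i + a * g i) ≡ sum f + a * sum g
  sum-axpy f a g = trans (∑-distrib-+ f (λ i → a * g i)) (cong (_+_ (sum f)) (sym (*-distribˡ-sum a g)))

  -- Once its first row is fixed, the Laplace expansion is such a combination of minors, with the
  -- signed entries of that row as coefficients.
  alt-∑ : ∀ n {m k} (a : Fin k → ℤ) {F : Fin k → Rows n m → ℤ} →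
          (∀ j → Alternating n (F j)) → Alternating n (λ A → ∑[ j < k ] (a j * F j A))
  alt-∑ ℕ.zero    a alts A≗B = sum-cong-≗ λ j → cong (a j *_) (alts j A≗B)
  alt-∑ (ℕ.suc n) a {F} alts =
    (λ A≗B → sum-cong-≗ λ j → cong (a j *_) (proj₁ (alts j) A≗B)) , record
    { linear = λ A → record
      { respects = λ v≗w → sum-cong-≗ λ j → cong (a j *_) (respects (linear (proj₂ (alts j)) A) v≗w)
      ; axpy = λ v b w → trans
          (sum-cong-≗ λ j → trans (cong (a j *_) (axpy (linear (proj₂ (alts j)) A) v b w)) (pull (a j) _ b _))
          (sum-axpy (λ j → a j * F j (v ∷ A)) b (λ j → a j * F j (w ∷ A)))
      }
    ; degenerate = deg n a (λ j → degenerate (proj₂ (alts j)))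
    ; rest = λ v → alt-∑ n a (λ j → rest (proj₂ (alts j)) v)
    }
    where
    pull : ∀ a x b y → a * (x + b * y) ≡ a * x + b * (a * y)
    pull = solve-∀
    deg : ∀ n {m k} (a : Fin k → ℤ) {F : Fin k → Rows (ℕ.suc n) m → ℤ} →
          (∀ j → Degenerate n (F j)) → Degenerate n (λ A → ∑[ j < k ] (a j * F j A))
    deg ℕ.zero    a ds     = tt
    deg (ℕ.suc n) a ds v A = sum-zero λ j → trans (cong (a j *_) (ds j v A)) (*-zeroʳ (a j))

  -- The two ways of deleting columns a ≤ b + 1, in either order, pair off the terms of
  -- the double Laplace expansion.
  ∑∑-antisym : ∀ n (H : Fin (ℕ.suc n) → Fin n → ℤ) →
               (∀ a b → toℕ a ℕ.≤ toℕ b → H (inject₁ a) b + H (suc b) a ≡ 0ℤ) →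
               ∑[ i < ℕ.suc n ] ∑[ j < n ] H i j ≡ 0ℤ
  ∑∑-antisym ℕ.zero    H anti = refl
  ∑∑-antisym (ℕ.suc n) H anti = begin
    sum (H zero) + ∑[ i < ℕ.suc n ] (H (suc i) zero + ∑[ j < n ] H (suc i) (suc j))
      ≡⟨ cong (_+_ (sum (H zero))) (∑-distrib-+ (λ i → H (suc i) zero) (λ i → ∑[ j < n ] H (suc i) (suc j))) ⟩
    sum (H zero) + (∑[ i < ℕ.suc n ] H (suc i) zero + ∑[ i < ℕ.suc n ] ∑[ j < n ] H (suc i) (suc j))
      ≡⟨ cong (λ x → sum (H zero) + (∑[ i < ℕ.suc n ] H (suc i) zero + x))
           (∑∑-antisym n (λ i j → H (suc i) (suc j)) λ a b a≤b → anti (suc a) (suc b) (s≤s a≤b)) ⟩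
    sum (H zero) + (∑[ i < ℕ.suc n ] H (suc i) zero + 0ℤ)
      ≡⟨ cong (_+_ (sum (H zero))) (+-identityʳ _) ⟩
    sum (H zero) + ∑[ i < ℕ.suc n ] H (suc i) zero
      ≡⟨ ∑-distrib-+ (H zero) (λ i → H (suc i) zero) ⟨
    ∑[ i < ℕ.suc n ] (H zero i + H (suc i) zero)
      ≡⟨ sum-zero (λ i → anti zero i z≤n) ⟩
    0ℤ ∎

  -- The Laplace determinant is alternating.

  punchIn-inject₁ : ∀ {n} (a b : Fin n) → toℕ a ℕ.≤ toℕ b → punchIn (inject₁ a) b ≡ suc b
  punchIn-inject₁ zero    b       _         = refl
  punchIn-inject₁ (suc a) (suc b) (s≤s a≤b) = cong suc (punchIn-inject₁ a b a≤b)

  punchIn-suc : ∀ {n} (a b : Fin n) → toℕ a ℕ.≤ toℕ b → punchIn (suc b) a ≡ inject₁ a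
  punchIn-suc zero    b       _         = refl
  punchIn-suc (suc a) (suc b) (s≤s a≤b) = cong suc (punchIn-suc a b a≤b)

  punchIn-punchIn : ∀ {n} (a b : Fin (ℕ.suc n)) k → toℕ a ℕ.≤ toℕ b →
                    punchIn (inject₁ a) (punchIn b k) ≡ punchIn (suc b) (punchIn a k)
  punchIn-punchIn zero    b       k       _         = refl
  punchIn-punchIn (suc a) (suc b) zero    _         = refl
  punchIn-punchIn (suc a) (suc b) (suc k) (s≤s a≤b) = cong suc (punchIn-punchIn a b k a≤b)

  det-cong : ∀ n → Respects (det {n})
  det-cong ℕ.zero    A≗B = refl
  det-cong (ℕ.suc n) A≗B = sum-cong-≗ {ℕ.suc n} λ j →
    cong₂ (λ x y → -1ℤ ^ toℕ j * x * y) (A≗B zero j) (det-cong n λ r k → A≗B (suc r) (punchIn j k))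

  -- Expanding along both equal rows gives a sum over ordered pairs of columns. Exchanging the two
  -- columns keeps the entries and the minor but flips the sign, because the right-hand column moves
  -- down one position once the left-hand one is deleted.
  det-degenerate : ∀ n → Degenerate n (det {ℕ.suc n})
  det-degenerate ℕ.zero        = tt
  det-degenerate (ℕ.suc n) v A = begin
    ∑[ i < ℕ.suc (ℕ.suc n) ] (s i * v i * ∑[ j < ℕ.suc n ] (s j * v (punchIn i j) * minor i j))
      ≡⟨ sum-cong-≗ {ℕ.suc (ℕ.suc n)} (λ i → *-distribˡ-sum (s i * v i) (λ j → s j * v (punchIn i j) * minor i j)) ⟩
    ∑[ i < ℕ.suc (ℕ.suc n) ] ∑[ j < ℕ.suc n ] H i j
      ≡⟨ ∑∑-antisym (ℕ.suc n) H anti ⟩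
    0ℤ ∎
    where
    s : ∀ {k} → Fin k → ℤ
    s i = -1ℤ ^ toℕ i
    minor : Fin (ℕ.suc (ℕ.suc n)) → Fin (ℕ.suc n) → ℤ
    minor i j = det (λ r k → A r (punchIn i (punchIn j k)))
    H : Fin (ℕ.suc (ℕ.suc n)) → Fin (ℕ.suc n) → ℤ
    H i j = s i * v i * (s j * v (punchIn i j) * minor i j)
    cancel : ∀ x y u w d → x * u * (y * w * d) + -1ℤ * y * w * (x * u * d) ≡ 0ℤ
    cancel = solve-∀
    anti : ∀ a b → toℕ a ℕ.≤ toℕ b → H (inject₁ a) b + H (suc b) a ≡ 0ℤ
    anti a b a≤b
      rewrite punchIn-inject₁ a b a≤b | punchIn-suc a b a≤b | toℕ-inject₁ a
            | det-cong n {λ r k → A r (punchIn (inject₁ a) (punchIn b k))}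
                (λ r k → cong (A r) (punchIn-punchIn a b k a≤b))
      = cancel (s a) (s b) (v (inject₁ a)) (v (suc b)) (minor (suc b) a)

  det-alternating : ∀ n → Alternating n (det {n})
  det-alternating ℕ.zero    = λ _ → refl
  det-alternating (ℕ.suc n) = det-cong (ℕ.suc n) , record
    { linear = λ A → record
      { respects = λ v≗w → det-cong (ℕ.suc n) (∷-cong {B = A} v≗w (λ _ _ → refl))
      ; axpy = λ v a w → trans
          (sum-cong-≗ {ℕ.suc n} λ j → spread (-1ℤ ^ toℕ j) (v j) a (w j) (minor A j))
          (sum-axpy (λ j → -1ℤ ^ toℕ j * v j * minor A j) a (λ j → -1ℤ ^ toℕ j * w j * minor A j))
      }
    ; degenerate = det-degenerate n
    ; rest = λ v → alt-∑ n (λ j → -1ℤ ^ toℕ j * v j) λ j →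
        alt-∘ n {L = _∘ punchIn j}
          (record { coordinate = λ k → record { respects = λ v≗w → v≗w _ ; axpy = λ _ _ _ → refl } })
          (det-alternating n)
    }
    where
    minor : Rows n (ℕ.suc n) → Fin (ℕ.suc n) → ℤ
    minor A j = det (λ r k → A r (punchIn j k))
    spread : ∀ s v a w d → s * (v + a * w) * d ≡ s * v * d + a * (s * w * d)
    spread = solve-∀

  -- Row operations and the uniqueness of the determinant.

  linear-zero : ∀ {m} {L : Row m → ℤ} → Linear L → L (λ _ → 0ℤ) ≡ 0ℤ
  linear-zero {L = L} lin = begin
    L (λ _ → 0ℤ)                  ≡⟨ axpy lin (λ _ → 0ℤ) -1ℤ (λ _ → 0ℤ) ⟩
    L (λ _ → 0ℤ) + -1ℤ * L (λ _ → 0ℤ) ≡⟨ cancel (L (λ _ → 0ℤ)) ⟩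
    0ℤ                            ∎
    where
    cancel : ∀ x → x + -1ℤ * x ≡ 0ℤ
    cancel = solve-∀

  -- Polarisation: F vanishes when the first two rows are both v + w, and expanding there leaves
  -- only the two mixed terms.
  swap₀₁ : ∀ n {m} {F : Rows (ℕ.suc (ℕ.suc n)) m → ℤ} → Alternating (ℕ.suc (ℕ.suc n)) F →
           ∀ v w A → F (v ∷ w ∷ A) ≡ -1ℤ * F (w ∷ v ∷ A)
  swap₀₁ n {F = F} (resp-F , step-F) v w A = begin
    G v w                                               ≡⟨ regroup (G v w) (G w v) (G v v) (G w w) ⟩
    -1ℤ * G w v + (G v v + 1ℤ * G v w + 1ℤ * (G w v + 1ℤ * G w w)) + -1ℤ * G v v + -1ℤ * G w w
      ≡⟨ cong (λ x → -1ℤ * G w v + x + -1ℤ * G v v + -1ℤ * G w w) (trans (sym expand) (G-self u)) ⟩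
    -1ℤ * G w v + 0ℤ + -1ℤ * G v v + -1ℤ * G w w
      ≡⟨ cong₂ (λ x y → -1ℤ * G w v + 0ℤ + -1ℤ * x + -1ℤ * y) (G-self v) (G-self w) ⟩
    -1ℤ * G w v + 0ℤ + -1ℤ * 0ℤ + -1ℤ * 0ℤ              ≡⟨ drop (-1ℤ * G w v) ⟩
    -1ℤ * G w v                                         ∎
    where
    G : Row _ → Row _ → ℤ
    G x y = F (x ∷ y ∷ A)
    G-self : ∀ x → G x x ≡ 0ℤ
    G-self x = degenerate step-F x A
    u : Row _
    u j = v j + 1ℤ * w j
    expand : G u u ≡ G v v + 1ℤ * G v w + 1ℤ * (G w v + 1ℤ * G w w)
    expand = trans (axpy (linear step-F (u ∷ A)) v 1ℤ w)
      (cong₂ (λ x y → x + 1ℤ * y) (axpy (linear (proj₂ (rest step-F v)) A) v 1ℤ w)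
                                  (axpy (linear (proj₂ (rest step-F w)) A) v 1ℤ w))
    regroup : ∀ a b c d → a ≡ -1ℤ * b + (c + 1ℤ * a + 1ℤ * (b + 1ℤ * d)) + -1ℤ * c + -1ℤ * d
    regroup = solve-∀
    drop : ∀ a → a + 0ℤ + -1ℤ * 0ℤ + -1ℤ * 0ℤ ≡ a
    drop = solve-∀

  -- The row v is swapped downwards until it meets its copy; each row it passes is then fixed,
  -- leaving a form in one row fewer.
  repeated-row : ∀ n {m} {F : Rows (ℕ.suc n) m → ℤ} → Alternating (ℕ.suc n) F →
                 ∀ v A k → A k ≗ v → F (v ∷ A) ≡ 0ℤ
  repeated-row (ℕ.suc n) {F = F} (resp-F , step-F) v A zero A₀≗v = trans
    (resp-F λ { zero j → refl ; (suc zero) j → A₀≗v j ; (suc (suc i)) j → refl })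
    (degenerate step-F v (tail A))
  repeated-row (ℕ.suc n) {F = F} alt@(resp-F , step-F) v A (suc k) Aₖ≗v = begin
    F (v ∷ A)                        ≡⟨ resp-F (λ { zero j → refl ; (suc zero) j → refl ; (suc (suc i)) j → refl }) ⟩
    F (v ∷ head A ∷ tail A)          ≡⟨ swap₀₁ n alt v (head A) (tail A) ⟩
    -1ℤ * F (head A ∷ v ∷ tail A)    ≡⟨ cong (-1ℤ *_) (repeated-row n (rest step-F (head A)) v (tail A) k Aₖ≗v) ⟩
    0ℤ                               ∎

  -- `H` is meant to be an alternating form whose first row has been fixed at v. The vanishing
  -- hypothesis keeps what alternation says about v, and it is inherited when further rows are
  -- fixed, as the recursion requires.
  add-multiples : ∀ n {m} {H : Rows n m → ℤ} → Alternating n H → ∀ v →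
                  (∀ A k → A k ≗ v → H A ≡ 0ℤ) → ∀ (a : Fin n → ℤ) A →
                  H (λ i j → A i j + a i * v j) ≡ H A
  add-multiples ℕ.zero    alt v kill a A = alt λ ()
  add-multiples (ℕ.suc n) {H = H} (resp-H , step-H) v kill a A = begin
    H (λ i j → A i j + a i * v j)                ≡⟨ resp-H (λ { zero j → refl ; (suc i) j → refl }) ⟩
    H ((λ j → head A j + head a * v j) ∷ B)      ≡⟨ axpy (linear step-H B) (head A) (head a) v ⟩
    H (head A ∷ B) + head a * H (v ∷ B)          ≡⟨ cong (λ x → H (head A ∷ B) + head a * x) (kill (v ∷ B) zero λ _ → refl) ⟩
    H (head A ∷ B) + head a * 0ℤ                 ≡⟨ trans (cong (_+_ (H (head A ∷ B))) (*-zeroʳ (head a))) (+-identityʳ _) ⟩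
    H (head A ∷ B)                               ≡⟨ add-multiples n (rest step-H (head A)) v
                                                      (λ C k Cₖ≗v → kill (head A ∷ C) (suc k) Cₖ≗v) (tail a) (tail A) ⟩
    H (head A ∷ tail A)                          ≡⟨ resp-H (λ { zero j → refl ; (suc i) j → refl }) ⟩
    H A                                          ∎
    where
    B : Rows n _
    B i j = tail A i j + tail a i * v j

  𝟙 : ∀ {n} → Matrix n
  𝟙 zero    zero    = 1ℤ
  𝟙 zero    (suc j) = 0ℤ
  𝟙 (suc i) zero    = 0ℤ
  𝟙 (suc i) (suc j) = 𝟙 i j

  linear-expand : ∀ {m} {L : Row m → ℤ} → Linear L → ∀ v → L v ≡ ∑[ j < m ] (v j * L (𝟙 j))
  linear-expand {ℕ.zero}  {L} lin v = trans (respects lin λ ()) (linear-zero lin)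
  linear-expand {ℕ.suc m} {L} lin v = begin
    L v                                                ≡⟨ respects lin (λ { zero → first (v zero) ; (suc j) → other (v (suc j)) (v zero) }) ⟩
    L (λ j → (0ℤ ∷ tail v) j + v zero * 𝟙 zero j)      ≡⟨ axpy lin (0ℤ ∷ tail v) (v zero) (𝟙 zero) ⟩
    L (0ℤ ∷ tail v) + v zero * L (𝟙 zero)              ≡⟨ +-comm (L (0ℤ ∷ tail v)) _ ⟩
    v zero * L (𝟙 zero) + L (0ℤ ∷ tail v)              ≡⟨ cong (_+_ (v zero * L (𝟙 zero))) (linear-expand lin′ (tail v)) ⟩
    v zero * L (𝟙 zero) + ∑[ j < m ] (v (suc j) * L (0ℤ ∷ 𝟙 j))
      ≡⟨ cong (_+_ (v zero * L (𝟙 zero))) (sum-cong-≗ {m} λ j →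
           cong (v (suc j) *_) (respects lin λ { zero → refl ; (suc k) → refl })) ⟩
    v zero * L (𝟙 zero) + ∑[ j < m ] (v (suc j) * L (𝟙 (suc j))) ∎
    where
    first : ∀ x → x ≡ 0ℤ + x * 1ℤ
    first = solve-∀
    other : ∀ x y → x ≡ x + y * 0ℤ
    other = solve-∀
    zeros : ∀ a → 0ℤ ≡ 0ℤ + a * 0ℤ
    zeros = solve-∀
    lin′ : Linear (λ w → L (0ℤ ∷ w))
    lin′ = record
      { respects = λ v≗w → respects lin λ { zero → refl ; (suc j) → v≗w j }
      ; axpy = λ v a w → trans (respects lin λ { zero → zeros a ; (suc j) → refl })
                               (axpy lin (0ℤ ∷ v) a (0ℤ ∷ w))
      }

  insertAt-linear : ∀ {n} (j : Fin (ℕ.suc n)) → LinearMap (λ v → insertAt v j 0ℤ)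
  insertAt-linear j = record { coordinate = λ k → record
    { respects = λ {v} {w} v≗w → resp-ins j k v≗w
    ; axpy = λ v a w → axpy-ins j k v a w
    } }
    where
    resp-ins : ∀ {n} (j : Fin (ℕ.suc n)) k {v w : Row n} → v ≗ w → insertAt v j 0ℤ k ≡ insertAt w j 0ℤ k
    resp-ins              zero    zero    v≗w = refl
    resp-ins              zero    (suc k) v≗w = v≗w k
    resp-ins {ℕ.suc n}    (suc j) zero    v≗w = v≗w zero
    resp-ins {ℕ.suc n}    (suc j) (suc k) v≗w = resp-ins j k (λ i → v≗w (suc i))
    zeros : ∀ a → 0ℤ ≡ 0ℤ + a * 0ℤ
    zeros = solve-∀
    axpy-ins : ∀ {n} (j : Fin (ℕ.suc n)) k (v : Row n) a w →
               insertAt (λ i → v i + a * w i) j 0ℤ k ≡ insertAt v j 0ℤ k + a * insertAt w j 0ℤ k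
    axpy-ins           zero    zero    v a w = zeros a
    axpy-ins           zero    (suc k) v a w = refl
    axpy-ins {ℕ.suc n} (suc j) zero    v a w = refl
    axpy-ins {ℕ.suc n} (suc j) (suc k) v a w = axpy-ins j k (tail v) a (tail w)

  clear-column : ∀ {n} (v : Row (ℕ.suc n)) j k →
                 v k + - v j * 𝟙 j k ≡ insertAt (v ∘ punchIn j) j 0ℤ k
  clear-column v zero zero = pivot (v zero)
    where
    pivot : ∀ x → x + - x * 1ℤ ≡ 0ℤ
    pivot = solve-∀
  clear-column v zero (suc k) = trans (cong (_+_ (v (suc k))) (*-zeroʳ (- v zero))) (+-identityʳ _)
  clear-column {ℕ.suc n} v (suc j) zero = trans (cong (_+_ (v zero)) (*-zeroʳ (- v (suc j)))) (+-identityʳ _)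
  clear-column {ℕ.suc n} v (suc j) (suc k) = clear-column (tail v) j k

  insertAt-𝟙 : ∀ {n} (j : Fin (ℕ.suc n)) k → insertAt (𝟙 k) j 0ℤ ≗ 𝟙 (punchIn j k)
  insertAt-𝟙 zero    k       zero    = refl
  insertAt-𝟙 zero    k       (suc l) = refl
  insertAt-𝟙 (suc j) zero    zero    = refl
  insertAt-𝟙 (suc j) zero    (suc l) = zeros j l
    where
    zeros : ∀ {n} (j : Fin (ℕ.suc n)) l → insertAt (λ _ → 0ℤ) j 0ℤ l ≡ 0ℤ
    zeros           zero    zero    = refl
    zeros           zero    (suc l) = refl
    zeros {ℕ.suc n} (suc j) zero    = refl
    zeros {ℕ.suc n} (suc j) (suc l) = zeros j l
  insertAt-𝟙 (suc j) (suc k) zero    = refl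
  insertAt-𝟙 (suc j) (suc k) (suc l) = insertAt-𝟙 j k l

  -- Bringing row j to the front takes j adjacent swaps; this accounts for the sign in the Laplace
  -- expansion.
  cycle-rows : ∀ n {m} {F : Rows (ℕ.suc n) m → ℤ} → Alternating (ℕ.suc n) F →
               ∀ j (u : Rows (ℕ.suc n) m) → F (u j ∷ (u ∘ punchIn j)) ≡ -1ℤ ^ toℕ j * F u
  cycle-rows n {F = F} (resp-F , step-F) zero u = trans
    (resp-F λ { zero j → refl ; (suc i) j → refl }) (sym (*-identityˡ (F u)))
  cycle-rows (ℕ.suc n) {F = F} alt@(resp-F , step-F) (suc j) u = begin
    F (u (suc j) ∷ (u ∘ punchIn (suc j)))
      ≡⟨ resp-F (λ { zero j → refl ; (suc zero) j → refl ; (suc (suc i)) j → refl }) ⟩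
    F (u (suc j) ∷ head u ∷ (tail u ∘ punchIn j))
      ≡⟨ swap₀₁ n alt (u (suc j)) (head u) (tail u ∘ punchIn j) ⟩
    -1ℤ * F (head u ∷ tail u j ∷ (tail u ∘ punchIn j))
      ≡⟨ cong (-1ℤ *_) (cycle-rows n (rest step-F (head u)) j (tail u)) ⟩
    -1ℤ * (-1ℤ ^ toℕ j * F (head u ∷ tail u))
      ≡⟨ *-assoc -1ℤ (-1ℤ ^ toℕ j) _ ⟨
    -1ℤ * -1ℤ ^ toℕ j * F (head u ∷ tail u)
      ≡⟨ cong (-1ℤ * -1ℤ ^ toℕ j *_) (resp-F λ { zero j → refl ; (suc i) j → refl }) ⟩
    -1ℤ * -1ℤ ^ toℕ j * F u ∎

  -- By linearity the first row may be taken to be a unit row `𝟙 j`. Subtracting multiples of it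
  -- clears column j in the other rows, and what remains is an alternating function of the minor, to
  -- which induction applies. Its value at the smaller identity is that of F at `𝟙` with row j moved
  -- to the front.
  det-unique : ∀ n {F : Matrix n → ℤ} → Alternating n F → ∀ A → F A ≡ det A * F 𝟙
  det-unique ℕ.zero    alt A = trans (alt λ ()) (sym (*-identityˡ _))
  det-unique (ℕ.suc n) {F} alt@(resp-F , step-F) A = begin
    F A                                                ≡⟨ resp-F (λ { zero j → refl ; (suc i) j → refl }) ⟩
    F (head A ∷ tail A)                                ≡⟨ linear-expand (linear step-F (tail A)) (head A) ⟩
    ∑[ j < ℕ.suc n ] (head A j * F (𝟙 j ∷ tail A))     ≡⟨ sum-cong-≗ {ℕ.suc n} (λ j → trans (cong (head A j *_) (term j))
                                                            (regroup (head A j) (minor j) (-1ℤ ^ toℕ j) (F 𝟙))) ⟩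
    ∑[ j < ℕ.suc n ] (-1ℤ ^ toℕ j * head A j * minor j * F 𝟙)
      ≡⟨ *-distribʳ-sum (F 𝟙) (λ j → -1ℤ ^ toℕ j * head A j * minor j) ⟨
    det A * F 𝟙                                        ∎
    where
    minor : Fin (ℕ.suc n) → ℤ
    minor j = det (λ r k → A (suc r) (punchIn j k))
    regroup : ∀ a d s f → a * (d * (s * f)) ≡ s * a * d * f
    regroup = solve-∀
    ins : Fin (ℕ.suc n) → Row n → Row (ℕ.suc n)
    ins j v = insertAt v j 0ℤ
    term : ∀ j → F (𝟙 j ∷ tail A) ≡ minor j * (-1ℤ ^ toℕ j * F 𝟙)
    term j = begin
      F (𝟙 j ∷ tail A)
        ≡⟨ add-multiples n (rest step-F (𝟙 j)) (𝟙 j) (λ B k → repeated-row n alt (𝟙 j) B k)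
             (λ i → - tail A i j) (tail A) ⟨
      F (𝟙 j ∷ (λ i k → tail A i k + - tail A i j * 𝟙 j k))
        ≡⟨ resp-F (∷-cong (λ _ → refl) (λ i → clear-column (tail A i) j)) ⟩
      F (𝟙 j ∷ (ins j ∘ (λ i → tail A i ∘ punchIn j)))
        ≡⟨ det-unique n (alt-∘ n (insertAt-linear j) (rest step-F (𝟙 j))) (λ i → tail A i ∘ punchIn j) ⟩
      minor j * F (𝟙 j ∷ (ins j ∘ 𝟙))
        ≡⟨ cong (minor j *_) (trans (resp-F (∷-cong (λ _ → refl) (insertAt-𝟙 j))) (cycle-rows n alt j 𝟙)) ⟩
      minor j * (-1ℤ ^ toℕ j * F 𝟙) ∎

  -- The product rule and diagonal factors.

  infixl 7 _⊗_
  _⊗_ : ∀ {n} → Matrix n → Matrix n → Matrix n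
  _⊗_ {n} A B i k = ∑[ j < n ] (A i j * B j k)

  ∑-𝟙 : ∀ {n} (i : Fin n) (v : Row n) → ∑[ j < n ] (𝟙 i j * v j) ≡ v i
  ∑-𝟙 {ℕ.suc n} zero v = begin
    1ℤ * v zero + ∑[ j < n ] (0ℤ * v (suc j))  ≡⟨ cong (_+_ (1ℤ * v zero)) (sum-zero {n} λ j → *-zeroˡ (v (suc j))) ⟩
    1ℤ * v zero + 0ℤ                           ≡⟨ +-identityʳ _ ⟩
    1ℤ * v zero                                ≡⟨ *-identityˡ _ ⟩
    v zero                                     ∎
  ∑-𝟙 {ℕ.suc n} (suc i) v = trans (cong₂ _+_ (*-zeroˡ (v zero)) (∑-𝟙 i (tail v))) (+-identityˡ _)

  -- As a function of A alone, `det (A ⊗ B)` is alternating and takes the value `det B` at the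
  -- identity, so `det-unique` applies.
  det-⊗ : ∀ {n} (A B : Matrix n) → det (A ⊗ B) ≡ det A * det B
  det-⊗ {n} A B = trans
    (det-unique n (alt-∘ n {L = λ v k → ∑[ j < n ] (v j * B j k)} lin (det-alternating n)) A)
    (cong (det A *_) (det-cong n λ i k → ∑-𝟙 i (λ j → B j k)))
    where
    spread : ∀ v a w b → (v + a * w) * b ≡ v * b + a * (w * b)
    spread = solve-∀
    lin : LinearMap (λ v k → ∑[ j < n ] (v j * B j k))
    lin = record { coordinate = λ k → record
      { respects = λ v≗w → sum-cong-≗ {n} λ j → cong (_* B j k) (v≗w j)
      ; axpy = λ v a w → trans (sum-cong-≗ {n} λ j → spread (v j) a (w j) (B j k))
                               (sum-axpy (λ j → v j * B j k) a (λ j → w j * B j k))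
      } }

  ∏ : ∀ {n} → (Fin n → ℤ) → ℤ
  ∏ = Prod.sum

  det-scale-rows : ∀ n (d : Fin n → ℤ) A → det (λ i j → d i * A i j) ≡ ∏ d * det A
  det-scale-rows ℕ.zero    d A = refl
  det-scale-rows (ℕ.suc n) d A = begin
    ∑[ j < ℕ.suc n ] (-1ℤ ^ toℕ j * (d zero * A zero j) * det (λ r k → d (suc r) * A (suc r) (punchIn j k)))
      ≡⟨ sum-cong-≗ {ℕ.suc n} (λ j → trans
           (cong (-1ℤ ^ toℕ j * (d zero * A zero j) *_) (det-scale-rows n (tail d) (λ r k → A (suc r) (punchIn j k))))
           (regroup (-1ℤ ^ toℕ j) (d zero) (A zero j) (∏ (tail d)) (minor j))) ⟩
    ∑[ j < ℕ.suc n ] (∏ d * (-1ℤ ^ toℕ j * A zero j * minor j))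
      ≡⟨ *-distribˡ-sum (∏ d) (λ j → -1ℤ ^ toℕ j * A zero j * minor j) ⟨
    ∏ d * det A ∎
    where
    minor : Fin (ℕ.suc n) → ℤ
    minor j = det (λ r k → A (suc r) (punchIn j k))
    regroup : ∀ s d a π m → s * (d * a) * (π * m) ≡ d * π * (s * a * m)
    regroup = solve-∀

  det-𝟙 : ∀ n → det {n} 𝟙 ≡ 1ℤ
  det-𝟙 ℕ.zero    = refl
  det-𝟙 (ℕ.suc n) = begin
    1ℤ * det {n} 𝟙 + ∑[ j < n ] (-1ℤ ^ ℕ.suc (toℕ j) * 0ℤ * minor j)
      ≡⟨ cong₂ (λ x y → 1ℤ * x + y) (det-𝟙 n) (sum-zero {n} λ j → vanish (-1ℤ ^ ℕ.suc (toℕ j)) (minor j)) ⟩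
    1ℤ ∎
    where
    minor : Fin n → ℤ
    minor j = det {n} (λ r k → 𝟙 (suc r) (punchIn (suc j) k))
    vanish : ∀ s d → s * 0ℤ * d ≡ 0ℤ
    vanish = solve-∀

  -- Linearity is known in the rows, so the column factors are written as a diagonal matrix on the
  -- right, whose determinant comes from scaling the rows of `𝟙`.
  det-scale-columns : ∀ n (A : Matrix n) (d : Fin n → ℤ) → det (λ i j → A i j * d j) ≡ det A * ∏ d
  det-scale-columns n A d = begin
    det (λ i j → A i j * d j)          ≡⟨ det-cong n (λ i j → linear-expand (scale j) (A i)) ⟩
    det (A ⊗ (λ i j → 𝟙 i j * d j))    ≡⟨ det-⊗ A _ ⟩
    det A * det (λ i j → 𝟙 i j * d j)  ≡⟨ cong (det A *_) (det-cong n λ i j → 𝟙-scale i j d) ⟩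
    det A * det (λ i j → d i * 𝟙 i j)  ≡⟨ cong (det A *_) (trans (det-scale-rows n d 𝟙)
                                            (trans (cong (∏ d *_) (det-𝟙 n)) (*-identityʳ (∏ d)))) ⟩
    det A * ∏ d                        ∎
    where
    spread : ∀ v a w b → (v + a * w) * b ≡ v * b + a * (w * b)
    spread = solve-∀
    scale : ∀ j → Linear (λ v → v j * d j)
    scale j = record
      { respects = λ v≗w → cong (_* d j) (v≗w j)
      ; axpy = λ v a w → spread (v j) a (w j) (d j)
      }
    𝟙-scale : ∀ {n} (i j : Fin n) (d : Fin n → ℤ) → 𝟙 i j * d j ≡ d i * 𝟙 i j
    𝟙-scale zero    zero    d = *-comm 1ℤ (d zero)
    𝟙-scale zero    (suc j) d = sym (*-zeroʳ (d zero))
    𝟙-scale (suc i) zero    d = sym (*-zeroʳ (d (suc i)))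
    𝟙-scale (suc i) (suc j) d = 𝟙-scale i j (tail d)

  𝟙-diagonal : ∀ {n} (i : Fin n) → 𝟙 i i ≡ 1ℤ
  𝟙-diagonal zero    = refl
  𝟙-diagonal (suc i) = 𝟙-diagonal i

  𝟙-off-diagonal : ∀ {n} {i j : Fin n} → i ≢ j → 𝟙 i j ≡ 0ℤ
  𝟙-off-diagonal {i = zero}  {zero}  i≢j = contradiction refl i≢j
  𝟙-off-diagonal {i = zero}  {suc j} i≢j = refl
  𝟙-off-diagonal {i = suc i} {zero}  i≢j = refl
  𝟙-off-diagonal {i = suc i} {suc j} i≢j = 𝟙-off-diagonal λ i≡j → i≢j (cong suc i≡j)

  ∏< : ℕ → (ℕ → ℤ) → ℤ
  ∏< N f = ∏ {N} (λ i → f (toℕ i))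

  ∏<-last : ∀ N f → ∏< (ℕ.suc N) f ≡ ∏< N f * f N
  ∏<-last ℕ.zero    f = *-comm (f 0) 1ℤ
  ∏<-last (ℕ.suc N) f = trans (cong (f 0 *_) (∏<-last N (λ i → f (ℕ.suc i)))) (sym (*-assoc (f 0) _ (f (ℕ.suc N))))

open Determinants

-- Congruence modulo p as an equality for sums, products and determinants.

module Congruence (p : ℕ) where

  infix 4 _≈_ _≉_

  -- A record rather than a synonym for divisibility, so that both sides can be inferred.
  record _≈_ (a b : ℤ) : Set where
    constructor ⟨_⟩
    field difference : a ≡ b [mod p ]
  open _≈_ public

  _≉_ : ℤ → ℤ → Set
  a ≉ b = ¬ a ≈ b

  _≈?_ : ∀ a b → Dec (a ≈ b)
  a ≈? b = map′ ⟨_⟩ difference (a ≡? b [mod p ])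

  ≡⇒≈ : ∀ {a b} → a ≡ b → a ≈ b
  ≡⇒≈ {a} refl = ⟨ divides 0ℤ (+-inverseʳ a) ⟩

  ≈-refl : ∀ {a} → a ≈ a
  ≈-refl = ≡⇒≈ refl

  ≈-sym : ∀ {a b} → a ≈ b → b ≈ a
  ≈-sym {a} {b} ⟨ d ⟩ = ⟨ subst (+ p ∣_) (flip a b) (∣m⇒∣-m d) ⟩
    where
    flip : ∀ a b → - (a - b) ≡ b - a
    flip = solve-∀

  ≈-trans : ∀ {a b c} → a ≈ b → b ≈ c → a ≈ c
  ≈-trans {a} {b} {c} ⟨ d ⟩ ⟨ e ⟩ = ⟨ subst (+ p ∣_) (telescope a b c) (∣m∣n⇒∣m+n d e) ⟩
    where
    telescope : ∀ a b c → (a - b) + (b - c) ≡ a - c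
    telescope = solve-∀

  +-cong : ∀ {a b c d} → a ≈ b → c ≈ d → a + c ≈ b + d
  +-cong {a} {b} {c} {d} ⟨ e ⟩ ⟨ f ⟩ = ⟨ subst (+ p ∣_) (exchange a b c d) (∣m∣n⇒∣m+n e f) ⟩
    where
    exchange : ∀ a b c d → (a - b) + (c - d) ≡ (a + c) - (b + d)
    exchange = solve-∀

  *-cong : ∀ {a b c d} → a ≈ b → c ≈ d → a * c ≈ b * d
  *-cong {a} {b} {c} {d} ⟨ e ⟩ ⟨ f ⟩ =
    ⟨ subst (+ p ∣_) (exchange a b c d) (∣m∣n⇒∣m+n (∣m⇒∣m*n c e) (∣n⇒∣m*n b f)) ⟩
    where
    exchange : ∀ a b c d → (a - b) * c + b * (c - d) ≡ a * c - b * d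
    exchange = solve-∀

  +-congˡ : ∀ a {b c} → b ≈ c → a + b ≈ a + c
  +-congˡ a b≈c = +-cong (≈-refl {a}) b≈c

  +-congʳ : ∀ a {b c} → b ≈ c → b + a ≈ c + a
  +-congʳ a b≈c = +-cong b≈c (≈-refl {a})

  *-congˡ : ∀ a {b c} → b ≈ c → a * b ≈ a * c
  *-congˡ a b≈c = *-cong (≈-refl {a}) b≈c

  *-congʳ : ∀ a {b c} → b ≈ c → b * a ≈ c * a
  *-congʳ a b≈c = *-cong b≈c (≈-refl {a})

  -‿cong : ∀ {a b} → a ≈ b → - a ≈ - b
  -‿cong {a} {b} ⟨ d ⟩ = ⟨ subst (+ p ∣_) (distrib a b) (∣m⇒∣-m d) ⟩
    where
    distrib : ∀ a b → - (a - b) ≡ - a - - b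
    distrib = solve-∀

  ^-cong : ∀ k {a b} → a ≈ b → a ^ k ≈ b ^ k
  ^-cong ℕ.zero    a≈b = ≈-refl
  ^-cong (ℕ.suc k) a≈b = *-cong a≈b (^-cong k a≈b)

  +-cancelˡ : ∀ {a b c} → a + b ≈ a + c → b ≈ c
  +-cancelˡ {a} {b} {c} ⟨ d ⟩ = ⟨ subst (+ p ∣_) (cancel a b c) d ⟩
    where
    cancel : ∀ a b c → (a + b) - (a + c) ≡ b - c
    cancel = solve-∀

  difference≈0 : ∀ {a b} → a - b ≈ 0ℤ → a ≈ b
  difference≈0 {a} {b} ⟨ d ⟩ = ⟨ subst (+ p ∣_) (+-identityʳ (a - b)) d ⟩

  p≈0 : + p ≈ 0ℤ
  p≈0 = ⟨ divides 1ℤ (unit (+ p)) ⟩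
    where
    unit : ∀ a → a - 0ℤ ≡ 1ℤ * a
    unit = solve-∀

  isEquivalence : IsEquivalence _≈_
  isEquivalence = record { refl = ≈-refl ; sym = ≈-sym ; trans = ≈-trans }

  -- Carrier and operation are those of the integers and only the equality is coarser, so sums
  -- formed here are the integer sums themselves, and general lemmas on congruence and permutation
  -- hold for them modulo p.
  +-0-commutativeMonoid-mod : CommutativeMonoid _ _
  +-0-commutativeMonoid-mod = record
    { isCommutativeMonoid = record
      { isMonoid = record
        { isSemigroup = record
          { isMagma = record { isEquivalence = isEquivalence ; ∙-cong = +-cong }
          ; assoc = λ a b c → ≡⇒≈ (+-assoc a b c) }
        ; identity = (λ a → ≡⇒≈ (+-identityˡ a)) , (λ a → ≡⇒≈ (+-identityʳ a)) }
      ; comm = λ a b → ≡⇒≈ (+-comm a b) } }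

  *-1-commutativeMonoid-mod : CommutativeMonoid _ _
  *-1-commutativeMonoid-mod = record
    { isCommutativeMonoid = record
      { isMonoid = record
        { isSemigroup = record
          { isMagma = record { isEquivalence = isEquivalence ; ∙-cong = *-cong }
          ; assoc = λ a b c → ≡⇒≈ (*-assoc a b c) }
        ; identity = (λ a → ≡⇒≈ (*-identityˡ a)) , (λ a → ≡⇒≈ (*-identityʳ a)) }
      ; comm = λ a b → ≡⇒≈ (*-comm a b) } }

  module SumMod  = Algebra.Properties.CommutativeMonoid.Sum +-0-commutativeMonoid-mod
  module ProdMod = Algebra.Properties.CommutativeMonoid.Sum *-1-commutativeMonoid-mod

  det-cong-mod : ∀ n {A B : Matrix n} → (∀ i j → A i j ≈ B i j) → det A ≈ det B
  det-cong-mod ℕ.zero    A≈B = ≈-refl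
  det-cong-mod (ℕ.suc n) A≈B = SumMod.sum-cong-≋ {ℕ.suc n} λ j →
    *-cong (*-congˡ (-1ℤ ^ toℕ j) (A≈B zero j)) (det-cong-mod n λ r k → A≈B (suc r) (punchIn j k))

-- Residues modulo a prime: reindexing, inverses, Fermat's theorem.

module PrimeField (n : ℕ) (p-prime : Prime (ℕ.suc (ℕ.suc n))) where

  -- The parameter n is p - 2, at once the exponent of the entries of D and the one that inverts
  -- nonzero residues.
  p p-1 : ℕ
  p = ℕ.suc (ℕ.suc n)
  p-1 = ℕ.suc n

  open Congruence p public

  setoid : Setoid _ _
  setoid = record { isEquivalence = isEquivalence }

  open import Relation.Binary.Reasoning.Setoid setoid

  zero-product : ∀ a b → a * b ≈ 0ℤ → a ≈ 0ℤ ⊎ b ≈ 0ℤ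
  zero-product a b ⟨ p∣ab ⟩ = Sum.map ⇒≈0 ⇒≈0
    (euclidsLemma ∣ a ∣ ∣ b ∣ p-prime (subst (p ℕ.∣_) (abs-* a b) (∣⇒∣ᵤ (subst (+ p ∣_) (+-identityʳ (a * b)) p∣ab))))
    where
    ⇒≈0 : ∀ {a} → p ℕ.∣ ∣ a ∣ → a ≈ 0ℤ
    ⇒≈0 {a} d = ⟨ subst (+ p ∣_) (sym (+-identityʳ a)) (∣ᵤ⇒∣ d) ⟩

  *-nonzero : ∀ {a b} → a ≉ 0ℤ → b ≉ 0ℤ → a * b ≉ 0ℤ
  *-nonzero {a} {b} a≉0 b≉0 ab≈0 = [ a≉0 , b≉0 ]′ (zero-product a b ab≈0)

  *-cancelˡ : ∀ {a b c} → a ≉ 0ℤ → a * b ≈ a * c → b ≈ c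
  *-cancelˡ {a} {b} {c} a≉0 ab≈ac = difference≈0
    (Sum.fromInj₂ (λ a≈0 → contradiction a≈0 a≉0) (zero-product a (b - c) (begin
      a * (b - c)    ≡⟨ distrib a b c ⟩
      a * b - a * c  ≈⟨ +-congʳ (- (a * c)) ab≈ac ⟩
      a * c - a * c  ≡⟨ +-inverseʳ (a * c) ⟩
      0ℤ             ∎)))
    where
    distrib : ∀ a b c → a * (b - c) ≡ a * b - a * c
    distrib = solve-∀

  toℕ-injective-mod : ∀ {i j} → i ℕ.< p → j ℕ.< p → + i ≈ + j → i ≡ j
  toℕ-injective-mod {i} {j} i<p j<p ⟨ p∣i-j ⟩ with ∣ + i - + j ∣ in eq
  ... | ℕ.zero  = +-injective (i-j≡0⇒i≡j (+ i) (+ j) (∣i∣≡0⇒i≡0 eq))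
  ... | ℕ.suc d = contradiction (subst (p ℕ.∣_) eq (∣⇒∣ᵤ p∣i-j)) (ℕ.>⇒∤ (subst (ℕ._< p) eq
      (ℕ.≤-<-trans (subst (λ a → ∣ a ∣ ℕ.≤ i ℕ.⊔ j) (sym (m-n≡m⊖n i j)) (∣m⊝n∣≤m⊔n i j)) (ℕ.⊔-pres-<m i<p j<p))))

  +suc≉0 : ∀ {i} → ℕ.suc i ℕ.< p → + ℕ.suc i ≉ 0ℤ
  +suc≉0 i<p si≈0 with toℕ-injective-mod i<p (ℕ.s≤s ℕ.z≤n) si≈0
  ... | ()

  0^suc : ∀ k {a} → a ≈ 0ℤ → a ^ ℕ.suc k ≈ 0ℤ
  0^suc k {a} a≈0 = *-congʳ (a ^ k) a≈0

  1≉0 : 1ℤ ≉ 0ℤ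
  1≉0 = +suc≉0 (ℕ.s≤s (ℕ.s≤s ℕ.z≤n))

  opaque
    residue : ℤ → Fin p
    residue a = fromℕ< (n%ℕd<d a p)

    residue-≈ : ∀ a → + toℕ (residue a) ≈ a
    residue-≈ a = begin
      + toℕ (residue a)                      ≡⟨ cong +_ (toℕ-fromℕ< (n%ℕd<d a p)) ⟩
      + (a %ℕ p)                             ≡⟨ +-identityʳ _ ⟨
      + (a %ℕ p) + 0ℤ                        ≡⟨ cong (_+_ (+ (a %ℕ p))) (*-zeroʳ (a /ℕ p)) ⟨
      + (a %ℕ p) + (a /ℕ p) * 0ℤ             ≈⟨ +-congˡ (+ (a %ℕ p)) (*-congˡ (a /ℕ p) p≈0) ⟨
      + (a %ℕ p) + (a /ℕ p) * + p            ≡⟨ a≡a%ℕn+[a/ℕn]*n a p ⟨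
      a                                      ∎

  WellDefined : (ℤ → ℤ) → Set
  WellDefined f = ∀ {a b} → a ≈ b → f a ≈ f b

  -- Maps that are mutually inverse modulo p permute the representatives 0, ..., p - 1 after
  -- reduction; every change of variable below rests on this.
  residue-permutation : (σ τ : ℤ → ℤ) → WellDefined σ → WellDefined τ →
                        (∀ a → σ (τ a) ≈ a) → (∀ a → τ (σ a) ≈ a) → Permutation p p
  residue-permutation σ τ σ-wd τ-wd στ τσ = permutation (on σ) (on τ) (inverse σ τ σ-wd στ) (inverse τ σ τ-wd τσ)
    where
    on : (ℤ → ℤ) → Fin p → Fin p
    on f i = residue (f (+ toℕ i))
    inverse : ∀ f g → WellDefined f → (∀ a → f (g a) ≈ a) → ∀ i → on f (on g i) ≡ i
    inverse f g f-wd fg i = toℕ-injective (toℕ-injective-mod (toℕ<n _) (toℕ<n i)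
      (≈-trans (residue-≈ _) (≈-trans (f-wd (residue-≈ (g (+ toℕ i)))) (fg (+ toℕ i)))))

  p-1≈-1 : + p-1 ≈ -1ℤ
  p-1≈-1 = begin
    + p-1        ≡⟨ shift (+ n) ⟩
    + p + -1ℤ    ≈⟨ +-congʳ -1ℤ p≈0 ⟩
    0ℤ + -1ℤ     ∎
    where
    shift : ∀ a → 1ℤ + a ≡ (1ℤ + (1ℤ + a)) + -1ℤ
    shift = solve-∀

  opaque
    ∑ₚ : (ℤ → ℤ) → ℤ
    ∑ₚ f = ∑[ i < p ] f (+ toℕ i)

    ∑ₚˣ : (ℤ → ℤ) → ℤ
    ∑ₚˣ f = ∑[ i < p-1 ] f (+ ℕ.suc (toℕ i))

    ∑ₚˣ-Fin : ∀ f → ∑ₚˣ f ≡ ∑[ i < p-1 ] f (+ ℕ.suc (toℕ i))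
    ∑ₚˣ-Fin f = refl

    ∑ₚ-split : ∀ f → ∑ₚ f ≡ f 0ℤ + ∑ₚˣ f
    ∑ₚ-split f = refl

    ∑ₚ-cong : ∀ {f g} → (∀ a → f a ≈ g a) → ∑ₚ f ≈ ∑ₚ g
    ∑ₚ-cong f≈g = SumMod.sum-cong-≋ {p} λ i → f≈g (+ toℕ i)

    ∑ₚˣ-cong : ∀ {f g} → (∀ a → a ≉ 0ℤ → f a ≈ g a) → ∑ₚˣ f ≈ ∑ₚˣ g
    ∑ₚˣ-cong f≈g = SumMod.sum-cong-≋ {p-1} λ i → f≈g (+ ℕ.suc (toℕ i)) (+suc≉0 (ℕ.s≤s (toℕ<n i)))

    ∑ₚ-+ : ∀ f g → ∑ₚ (λ a → f a + g a) ≡ ∑ₚ f + ∑ₚ g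
    ∑ₚ-+ f g = ∑-distrib-+ {p} (λ i → f (+ toℕ i)) (λ i → g (+ toℕ i))

    ∑ₚ-*ˡ : ∀ x f → ∑ₚ (λ a → x * f a) ≡ x * ∑ₚ f
    ∑ₚ-*ˡ x f = sym (*-distribˡ-sum {p} x (λ i → f (+ toℕ i)))

    ∑ₚˣ-*ˡ : ∀ x f → ∑ₚˣ (λ a → x * f a) ≡ x * ∑ₚˣ f
    ∑ₚˣ-*ˡ x f = sym (*-distribˡ-sum {p-1} x (λ i → f (+ ℕ.suc (toℕ i))))

    ∑ₚˣ-∑ₚ-comm : ∀ (f : ℤ → ℤ → ℤ) → ∑ₚˣ (λ a → ∑ₚ (f a)) ≡ ∑ₚ (λ b → ∑ₚˣ (λ a → f a b))
    ∑ₚˣ-∑ₚ-comm f = ∑-comm {p-1} {p} λ i j → f (+ ℕ.suc (toℕ i)) (+ toℕ j)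

    ∑ₚˣ-1 : ∑ₚˣ (λ _ → 1ℤ) ≈ -1ℤ
    ∑ₚˣ-1 = begin
      ∑[ i < p-1 ] 1ℤ  ≡⟨ sum-1 p-1 ⟩
      + p-1            ≈⟨ p-1≈-1 ⟩
      -1ℤ              ∎
      where
      sum-1 : ∀ k → ∑[ i < k ] 1ℤ ≡ + k
      sum-1 ℕ.zero    = refl
      sum-1 (ℕ.suc k) = cong (_+_ 1ℤ) (sum-1 k)

    ∑ₚ-substitute : ∀ {f} (σ τ : ℤ → ℤ) → WellDefined f → WellDefined σ → WellDefined τ →
                    (∀ a → σ (τ a) ≈ a) → (∀ a → τ (σ a) ≈ a) → ∑ₚ (λ a → f (σ a)) ≈ ∑ₚ f
    ∑ₚ-substitute {f} σ τ f-wd σ-wd τ-wd στ τσ = ≈-sym (≈-trans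
      (SumMod.sum-permute {p} (λ i → f (+ toℕ i)) (residue-permutation σ τ σ-wd τ-wd στ τσ))
      (SumMod.sum-cong-≋ {p} λ i → f-wd (residue-≈ (σ (+ toℕ i)))))

  opaque
    -- Obtained from Bézout ahead of `fermat`, which must exhibit the inverse of multiplication by
    -- a; from then on `inv` takes over.
    inverse : ∀ {a} → a ≉ 0ℤ → ∃[ b ] a * b ≈ 1ℤ
    inverse {a} a≉0 with toℕ (residue a) | toℕ<n (residue a) | residue-≈ a
    ... | ℕ.zero  | _   | 0≈a = contradiction (≈-sym 0≈a) a≉0
    ... | ℕ.suc i | i<p | i≈a with coprime-Bézout (prime⇒coprime p-prime i<p)
    ...   | Bézout.+- x y eq = - + y , (begin
              a * - + y                        ≈⟨ *-congʳ (- + y) i≈a ⟨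
              + ℕ.suc i * - + y                ≡⟨ rearrange (+ ℕ.suc i) (+ y) ⟩
              1ℤ + - (1ℤ + + y * + ℕ.suc i)    ≡⟨ cong (λ z → 1ℤ + - (1ℤ + z)) (pos-* y (ℕ.suc i)) ⟨
              1ℤ + - + (1 ℕ.+ y ℕ.* ℕ.suc i)   ≡⟨ cong (λ z → 1ℤ + - + z) eq ⟩
              1ℤ + - + (x ℕ.* p)               ≈⟨ +-congˡ 1ℤ (-‿cong (multiple x)) ⟩
              1ℤ                               ∎)
      where
      rearrange : ∀ a b → a * - b ≡ 1ℤ + - (1ℤ + b * a)
      rearrange = solve-∀
      multiple : ∀ x → + (x ℕ.* p) ≈ 0ℤ
      multiple x = ≈-trans (≡⇒≈ (pos-* x p)) (≈-trans (*-congˡ (+ x) p≈0) (≡⇒≈ (*-zeroʳ (+ x))))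
    ...   | Bézout.-+ x y eq = + y , (begin
              a * + y                          ≈⟨ *-congʳ (+ y) i≈a ⟨
              + ℕ.suc i * + y                  ≡⟨ *-comm (+ ℕ.suc i) (+ y) ⟩
              + y * + ℕ.suc i                  ≡⟨ pos-* y (ℕ.suc i) ⟨
              + (y ℕ.* ℕ.suc i)                ≡⟨ cong +_ eq ⟨
              1ℤ + + (x ℕ.* p)                 ≡⟨ cong (_+_ 1ℤ) (pos-* x p) ⟩
              1ℤ + + x * + p                   ≈⟨ +-congˡ 1ℤ (*-congˡ (+ x) p≈0) ⟩
              1ℤ + + x * 0ℤ                    ≡⟨ cong (_+_ 1ℤ) (*-zeroʳ (+ x)) ⟩
              1ℤ                               ∎)

  ∏-nonzero : ∀ {k} (f : Fin k → ℤ) → (∀ i → f i ≉ 0ℤ) → ∏ f ≉ 0ℤ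
  ∏-nonzero {ℕ.zero}  f f≉0 = 1≉0
  ∏-nonzero {ℕ.suc k} f f≉0 = *-nonzero (f≉0 zero) (∏-nonzero (tail f) (λ i → f≉0 (suc i)))

  -- Replacing 0 by 1 lets the product of the nonzero residues run over all of `Fin p`, on which the
  -- permutations act.
  unitPart : ℤ → ℤ
  unitPart a = if does (a ≈? 0ℤ) then 1ℤ else a

  unitPart-zero : ∀ {a} → a ≈ 0ℤ → unitPart a ≡ 1ℤ
  unitPart-zero {a} a≈0 = cong (if_then 1ℤ else a) (dec-true (a ≈? 0ℤ) a≈0)

  unitPart-nonzero : ∀ {a} → a ≉ 0ℤ → unitPart a ≡ a
  unitPart-nonzero {a} a≉0 = cong (if_then 1ℤ else a) (dec-false (a ≈? 0ℤ) a≉0)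

  unitPart-wd : WellDefined unitPart
  unitPart-wd {a} {b} a≈b with a ≈? 0ℤ
  ... | yes a≈0 = ≡⇒≈ (trans (unitPart-zero {a} a≈0) (sym (unitPart-zero {b} (≈-trans (≈-sym a≈b) a≈0))))
  ... | no  a≉0 = ≈-trans (≡⇒≈ (unitPart-nonzero {a} a≉0)) (≈-trans a≈b (≡⇒≈ (sym (unitPart-nonzero {b} λ b≈0 → a≉0 (≈-trans a≈b b≈0)))))

  -- Multiplication by a permutes the nonzero residues, hence preserves their product.
  fermat : ∀ {a} → a ≉ 0ℤ → a ^ p-1 ≈ 1ℤ
  fermat {a} a≉0 = *-cancelˡ X≉0 (begin
    X * a ^ p-1                                            ≡⟨ *-comm X (a ^ p-1) ⟩
    a ^ p-1 * X                                            ≡⟨ ∏-scale p-1 unit ⟨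
    ∏ {p-1} (λ i → a * unit i)                             ≈⟨ ProdMod.sum-cong-≋ {p-1} (λ i → ≡⇒≈ (sym (unitPart-nonzero {a * unit i} (*-nonzero a≉0 (unit≉0 i))))) ⟩
    ∏ {p-1} (λ i → unitPart (a * unit i))                  ≡⟨ *-identityˡ _ ⟨
    1ℤ * ∏ {p-1} (λ i → unitPart (a * unit i))             ≡⟨ cong (_* ∏ {p-1} (λ i → unitPart (a * unit i))) (unitPart-zero {a * 0ℤ} (≡⇒≈ (*-zeroʳ a))) ⟨
    ∏ {p} (λ i → unitPart (a * + toℕ i))                   ≈⟨ ProdMod.sum-cong-≋ {p} (λ i → unitPart-wd (≈-sym (residue-≈ (a * + toℕ i)))) ⟩
    ∏ {p} (λ i → unitPart (+ toℕ (residue (a * + toℕ i)))) ≈⟨ ProdMod.sum-permute {p} (λ i → unitPart (+ toℕ i)) π ⟨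
    ∏ {p} (λ i → unitPart (+ toℕ i))                       ≡⟨ cong (_* ∏ {p-1} (λ i → unitPart (unit i))) (unitPart-zero {0ℤ} ≈-refl) ⟩
    1ℤ * ∏ {p-1} (λ i → unitPart (unit i))                 ≈⟨ *-congˡ 1ℤ (ProdMod.sum-cong-≋ {p-1} (λ i → ≡⇒≈ (unitPart-nonzero {unit i} (unit≉0 i)))) ⟩
    1ℤ * X                                                 ≡⟨ *-comm 1ℤ X ⟩
    X * 1ℤ                                                 ∎)
    where
    b = proj₁ (inverse a≉0)
    ab≈1 = proj₂ (inverse a≉0)
    unit : Fin p-1 → ℤ
    unit i = + ℕ.suc (toℕ i)
    unit≉0 : ∀ i → unit i ≉ 0ℤ
    unit≉0 i = +suc≉0 (ℕ.s≤s (toℕ<n i))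
    X = ∏ unit
    X≉0 : X ≉ 0ℤ
    X≉0 = ∏-nonzero unit unit≉0
    undo : ∀ c → a * (b * c) ≈ c
    undo c = ≈-trans (≡⇒≈ (sym (*-assoc a b c))) (≈-trans (*-congʳ c ab≈1) (≡⇒≈ (*-identityˡ c)))
    swap : ∀ x y z → x * (y * z) ≡ y * (x * z)
    swap = solve-∀
    π : Permutation p p
    π = residue-permutation (a *_) (b *_) (*-congˡ a) (*-congˡ b) undo (λ c → ≈-trans (≡⇒≈ (swap b a c)) (undo c))
    ∏-scale : ∀ k (f : Fin k → ℤ) → ∏ (λ i → a * f i) ≡ a ^ k * ∏ f
    ∏-scale ℕ.zero    f = refl
    ∏-scale (ℕ.suc k) f = trans (cong (a * f zero *_) (∏-scale k (tail f))) (exchange a (f zero) (a ^ k) (∏ (tail f)))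
      where
      exchange : ∀ a x y z → a * x * (y * z) ≡ a * y * (x * z)
      exchange = solve-∀

  -- Being a power, it is defined at every residue and respects congruence; for odd p it fixes 0 and
  -- so is an involution of all residues.
  inv : ℤ → ℤ
  inv a = a ^ n

  *-inv : ∀ {a} → a ≉ 0ℤ → a * inv a ≈ 1ℤ
  *-inv = fermat

  ∑ₚ-shift : ∀ {f} → WellDefined f → ∀ b → ∑ₚ (λ a → f (a + b)) ≈ ∑ₚ f
  ∑ₚ-shift f-wd b = ∑ₚ-substitute (_+ b) (_- b) f-wd (+-congʳ b) (+-congʳ (- b))
    (λ a → ≡⇒≈ (there a b)) (λ a → ≡⇒≈ (back a b))
    where
    there : ∀ a b → a - b + b ≡ a
    there = solve-∀
    back : ∀ a b → a + b - b ≡ a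
    back = solve-∀

  ∑ₚ-scale : ∀ {f} → WellDefined f → ∀ {b} → b ≉ 0ℤ → ∑ₚ (λ a → f (b * a)) ≈ ∑ₚ f
  ∑ₚ-scale f-wd {b} b≉0 = ∑ₚ-substitute (b *_) (inv b *_) f-wd (*-congˡ b) (*-congˡ (inv b))
    undo (λ a → ≈-trans (≡⇒≈ (swap (inv b) b a)) (undo a))
    where
    swap : ∀ x y z → x * (y * z) ≡ y * (x * z)
    swap = solve-∀
    undo : ∀ a → b * (inv b * a) ≈ a
    undo a = begin
      b * (inv b * a)  ≡⟨ *-assoc b (inv b) a ⟨
      b * inv b * a    ≈⟨ *-congʳ a (*-inv b≉0) ⟩
      1ℤ * a           ≡⟨ *-identityˡ a ⟩
      a                ∎

  ∑ₚˣ-from-∑ₚ : ∀ f g → f 0ℤ ≈ g 0ℤ → ∑ₚ f ≈ ∑ₚ g → ∑ₚˣ f ≈ ∑ₚˣ g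
  ∑ₚˣ-from-∑ₚ f g f0≈g0 ∑f≈∑g = +-cancelˡ {f 0ℤ} (begin
    f 0ℤ + ∑ₚˣ f  ≡⟨ ∑ₚ-split f ⟨
    ∑ₚ f          ≈⟨ ∑f≈∑g ⟩
    ∑ₚ g          ≡⟨ ∑ₚ-split g ⟩
    g 0ℤ + ∑ₚˣ g  ≈⟨ +-congʳ (∑ₚˣ g) f0≈g0 ⟨
    f 0ℤ + ∑ₚˣ g  ∎)

  ∑ₚˣ≈∑ₚ : ∀ f → f 0ℤ ≈ 0ℤ → ∑ₚˣ f ≈ ∑ₚ f
  ∑ₚˣ≈∑ₚ f f0≈0 = begin
    ∑ₚˣ f         ≡⟨ +-identityˡ (∑ₚˣ f) ⟨
    0ℤ + ∑ₚˣ f    ≈⟨ +-congʳ (∑ₚˣ f) f0≈0 ⟨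
    f 0ℤ + ∑ₚˣ f  ≡⟨ ∑ₚ-split f ⟨
    ∑ₚ f          ∎

  ∑ₚˣ-scale : ∀ {f} → WellDefined f → ∀ {b} → b ≉ 0ℤ → ∑ₚˣ f ≈ ∑ₚˣ (λ a → f (b * a))
  ∑ₚˣ-scale {f} f-wd {b} b≉0 = ∑ₚˣ-from-∑ₚ f (λ a → f (b * a))
    (f-wd (≡⇒≈ (sym (*-zeroʳ b)))) (≈-sym (∑ₚ-scale f-wd b≉0))

  -- Power sums over the residues.

  ^-distribʳ-* : ∀ k a b → (a * b) ^ k ≡ a ^ k * b ^ k
  ^-distribʳ-* ℕ.zero    a b = refl
  ^-distribʳ-* (ℕ.suc k) a b = trans (cong (a * b *_) (^-distribʳ-* k a b)) (exchange a b (a ^ k) (b ^ k))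
    where
    exchange : ∀ a b x y → a * b * (x * y) ≡ a * x * (b * y)
    exchange = solve-∀

  -- The falling factorial a (a - 1) ⋯ (a - k + 1). Its differences are multiples of falling
  -- factorials, which makes sums round the cycle of residues telescope.
  falling : ℕ → ℤ → ℤ
  falling ℕ.zero    a = 1ℤ
  falling (ℕ.suc k) a = falling k a * (a - + k)

  falling-wd : ∀ k → WellDefined (falling k)
  falling-wd ℕ.zero    a≈b = ≈-refl
  falling-wd (ℕ.suc k) a≈b = *-cong (falling-wd k a≈b) (+-congʳ (- + k) a≈b)

  falling-shift : ∀ k a → falling (ℕ.suc k) (a + 1ℤ) ≡ (a + 1ℤ) * falling k a
  falling-shift ℕ.zero    a = base a
    where
    base : ∀ a → 1ℤ * (a + 1ℤ - 0ℤ) ≡ (a + 1ℤ) * 1ℤ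
    base = solve-∀
  falling-shift (ℕ.suc k) a = trans
    (cong (_* (a + 1ℤ - + ℕ.suc k)) (falling-shift k a)) (step a (falling k a) (+ k))
    where
    step : ∀ a f k → (a + 1ℤ) * f * (a + 1ℤ - (1ℤ + k)) ≡ (a + 1ℤ) * (f * (a - k))
    step = solve-∀

  -- Multiplied by k + 1, the summand is the difference of the next falling factorial between a + 1
  -- and a, and a shift does not change a sum over all residues. As k < p - 1, the factor k + 1 is a
  -- unit.
  ∑-falling : ∀ k → k ℕ.< p-1 → ∑ₚ (falling k) ≈ 0ℤ
  ∑-falling k k<p-1 = *-cancelˡ {+ ℕ.suc k} (+suc≉0 (ℕ.s≤s k<p-1)) (begin
    + ℕ.suc k * ∑ₚ (falling k)                                   ≡⟨ ∑ₚ-*ˡ (+ ℕ.suc k) (falling k) ⟨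
    ∑ₚ (λ a → + ℕ.suc k * falling k a)                           ≈⟨ ∑ₚ-cong (λ a → ≡⇒≈ (difference-falling a)) ⟩
    ∑ₚ (λ a → f (a + 1ℤ) + -1ℤ * f a)                            ≡⟨ ∑ₚ-+ (λ a → f (a + 1ℤ)) (λ a → -1ℤ * f a) ⟩
    ∑ₚ (λ a → f (a + 1ℤ)) + ∑ₚ (λ a → -1ℤ * f a)                 ≡⟨ cong (_+_ (∑ₚ (λ a → f (a + 1ℤ)))) (∑ₚ-*ˡ -1ℤ f) ⟩
    ∑ₚ (λ a → f (a + 1ℤ)) + -1ℤ * ∑ₚ f                           ≈⟨ +-congʳ (-1ℤ * ∑ₚ f) shift-sum ⟩
    ∑ₚ f + -1ℤ * ∑ₚ f                                            ≡⟨ cancel (∑ₚ f) (+ ℕ.suc k) ⟩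
    + ℕ.suc k * 0ℤ                                               ∎)
    where
    f = falling (ℕ.suc k)
    expand : ∀ a f k → (1ℤ + k) * f ≡ (a + 1ℤ) * f + -1ℤ * (f * (a - k))
    expand = solve-∀
    difference-falling : ∀ a → + ℕ.suc k * falling k a ≡ f (a + 1ℤ) + -1ℤ * f a
    difference-falling a = trans (expand a (falling k a) (+ k))
      (cong (_+ -1ℤ * f a) (sym (falling-shift k a)))
    cancel : ∀ x y → x + -1ℤ * x ≡ y * 0ℤ
    cancel = solve-∀
    shift-sum : ∑ₚ (λ a → f (a + 1ℤ)) ≈ ∑ₚ f
    shift-sum = ∑ₚ-shift (falling-wd (ℕ.suc k)) 1ℤ

  -- These products interpolate between falling factorials (j = 0) and powers (k = 0). Writing a =
  -- (a - k) + k trades a factor a for a longer falling factorial, and k + j never grows.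
  ∑-falling-^ : ∀ j k → k ℕ.+ j ℕ.< p-1 → ∑ₚ (λ a → falling k a * a ^ j) ≈ 0ℤ
  ∑-falling-^ ℕ.zero    k k+0<p-1 = ≈-trans (∑ₚ-cong λ a → ≡⇒≈ (*-identityʳ (falling k a)))
    (∑-falling k (subst (ℕ._< p-1) (ℕ.+-identityʳ k) k+0<p-1))
  ∑-falling-^ (ℕ.suc j) k k+1+j<p-1 = begin
    ∑ₚ (λ a → falling k a * (a * a ^ j))                     ≈⟨ ∑ₚ-cong (λ a → ≡⇒≈ (recurrence (falling k a) a (a ^ j) (+ k))) ⟩
    ∑ₚ (λ a → falling (ℕ.suc k) a * a ^ j + + k * (falling k a * a ^ j))
      ≡⟨ trans (∑ₚ-+ (λ a → falling (ℕ.suc k) a * a ^ j) (λ a → + k * (falling k a * a ^ j)))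
               (cong (_+_ (∑ₚ (λ a → falling (ℕ.suc k) a * a ^ j))) (∑ₚ-*ˡ (+ k) (λ a → falling k a * a ^ j))) ⟩
    ∑ₚ (λ a → falling (ℕ.suc k) a * a ^ j) + + k * ∑ₚ (λ a → falling k a * a ^ j)
      ≈⟨ +-cong (∑-falling-^ j (ℕ.suc k) 1+k+j<p-1) (*-congˡ (+ k) (∑-falling-^ j k (ℕ.<-trans (ℕ.n<1+n _) 1+k+j<p-1))) ⟩
    0ℤ + + k * 0ℤ                                            ≡⟨ trans (+-identityˡ (+ k * 0ℤ)) (*-zeroʳ (+ k)) ⟩
    0ℤ                                                       ∎
    where
    1+k+j<p-1 : ℕ.suc (k ℕ.+ j) ℕ.< p-1
    1+k+j<p-1 = subst (ℕ._< p-1) (ℕ.+-suc k j) k+1+j<p-1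
    recurrence : ∀ f a x k → f * (a * x) ≡ f * (a - k) * x + k * (f * x)
    recurrence = solve-∀

  ∑-^ : ∀ j → j ℕ.< p-1 → ∑ₚ (_^ j) ≈ 0ℤ
  ∑-^ j j<p-1 = ≈-trans (∑ₚ-cong λ a → ≡⇒≈ (sym (*-identityˡ (a ^ j)))) (∑-falling-^ j 0 j<p-1)

  ∑-^p-1 : ∑ₚ (_^ p-1) ≈ -1ℤ
  ∑-^p-1 = begin
    ∑ₚ (_^ p-1)             ≡⟨ ∑ₚ-split (_^ p-1) ⟩
    0ℤ ^ p-1 + ∑ₚˣ (_^ p-1) ≈⟨ +-cong (0^suc n ≈-refl) (≈-trans (∑ₚˣ-cong λ a a≉0 → fermat a≉0) ∑ₚˣ-1) ⟩
    0ℤ + -1ℤ                ∎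

  -- The exponent starts at 1 because 0 to the power 0 is 1, whereas 0 to the power p - 1 is 0.
  ^-period : ∀ j a → a ^ (ℕ.suc j ℕ.+ p-1) ≈ a ^ ℕ.suc j
  ^-period j a with a ≈? 0ℤ
  ... | yes a≈0 = ≈-trans (0^suc (j ℕ.+ p-1) a≈0) (≈-sym (0^suc j a≈0))
  ... | no  a≉0 = begin
    a ^ (ℕ.suc j ℕ.+ p-1)  ≡⟨ ^-distribˡ-+-* a (ℕ.suc j) p-1 ⟩
    a ^ ℕ.suc j * a ^ p-1  ≈⟨ *-congˡ (a ^ ℕ.suc j) (fermat a≉0) ⟩
    a ^ ℕ.suc j * 1ℤ       ≡⟨ *-identityʳ _ ⟩
    a ^ ℕ.suc j            ∎

  -- The sums ∑ aʲ q(a)ᴺ for a quadratic q, evaluated as if by expanding q(a)ᴺ in powers of a: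
  -- only the coefficient of a^(p-1) survives.
  module QuadraticSum (A B C : ℤ) where

    q : ℤ → ℤ
    q a = A + B * a + C * (a * a)

    T : ℕ → ℕ → ℤ
    T N j = ∑ₚ (λ a → a ^ j * q a ^ N)

    T-suc : ∀ N j → T (ℕ.suc N) j ≈ A * T N j + B * T N (ℕ.suc j) + C * T N (2 ℕ.+ j)
    T-suc N j = begin
      T (ℕ.suc N) j                       ≈⟨ ∑ₚ-cong (λ a → ≡⇒≈ (expand A B C a (a ^ j) (q a ^ N))) ⟩
      ∑ₚ (λ a → A * t j a + B * t (ℕ.suc j) a + C * t (2 ℕ.+ j) a)
        ≡⟨ ∑ₚ-+ (λ a → A * t j a + B * t (ℕ.suc j) a) (λ a → C * t (2 ℕ.+ j) a) ⟩
      ∑ₚ (λ a → A * t j a + B * t (ℕ.suc j) a) + ∑ₚ (λ a → C * t (2 ℕ.+ j) a)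
        ≡⟨ cong₂ _+_ (∑ₚ-+ (λ a → A * t j a) (λ a → B * t (ℕ.suc j) a)) (∑ₚ-*ˡ C (t (2 ℕ.+ j))) ⟩
      ∑ₚ (λ a → A * t j a) + ∑ₚ (λ a → B * t (ℕ.suc j) a) + C * T N (2 ℕ.+ j)
        ≡⟨ cong₂ (λ x y → x + y + C * T N (2 ℕ.+ j)) (∑ₚ-*ˡ A (t j)) (∑ₚ-*ˡ B (t (ℕ.suc j))) ⟩
      A * T N j + B * T N (ℕ.suc j) + C * T N (2 ℕ.+ j) ∎
      where
      t : ℕ → ℤ → ℤ
      t j a = a ^ j * q a ^ N
      expand : ∀ A B C a x y → x * ((A + B * a + C * (a * a)) * y) ≡
               A * (x * y) + B * (a * x * y) + C * (a * (a * x) * y)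
      expand = solve-∀

    T-cong : ∀ N i j → (∀ a → a ^ i ≈ a ^ j) → T N i ≈ T N j
    T-cong N i j i≈j = ∑ₚ-cong λ a → *-congʳ (q a ^ N) (i≈j a)

    combine : ∀ {x y z x′ y′ z′} → x ≈ x′ → y ≈ y′ → z ≈ z′ → A * x + B * y + C * z ≈ A * x′ + B * y′ + C * z′
    combine x≈ y≈ z≈ = +-cong (+-cong (*-congˡ A x≈) (*-congˡ B y≈)) (*-congˡ C z≈)

    -- Every power of a in the expansion has its exponent strictly between 0 and p - 1.
    T-low : ∀ N j → ℕ.suc j ℕ.+ (N ℕ.+ N) ℕ.< p-1 → T N (ℕ.suc j) ≈ 0ℤ
    T-low ℕ.zero    j j<p-1 = ≈-trans (∑ₚ-cong λ a → ≡⇒≈ (*-identityʳ (a ^ ℕ.suc j)))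
      (∑-^ (ℕ.suc j) (subst (ℕ._< p-1) (ℕ.+-identityʳ (ℕ.suc j)) j<p-1))
    T-low (ℕ.suc N) j j<p-1 = begin
      T (ℕ.suc N) (ℕ.suc j)      ≈⟨ T-suc N (ℕ.suc j) ⟩
      A * T N (ℕ.suc j) + B * T N (2 ℕ.+ j) + C * T N (3 ℕ.+ j)
        ≈⟨ combine (T-low N j (ℕ.<-trans (ℕ.n<1+n _) (ℕ.<-trans (ℕ.n<1+n _) bound)))
                   (T-low N (1 ℕ.+ j) (ℕ.<-trans (ℕ.n<1+n _) bound)) (T-low N (2 ℕ.+ j) bound) ⟩
      A * 0ℤ + B * 0ℤ + C * 0ℤ   ≡⟨ zeros A B C ⟩
      0ℤ                         ∎
      where
      zeros : ∀ A B C → A * 0ℤ + B * 0ℤ + C * 0ℤ ≡ 0ℤ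
      zeros = solve-∀
      bound : 3 ℕ.+ j ℕ.+ (N ℕ.+ N) ℕ.< p-1
      bound = subst (ℕ._< p-1) (cong ℕ.suc (trans (cong (λ x → j ℕ.+ ℕ.suc x) (ℕ.+-suc N N))
                (trans (ℕ.+-suc j _) (cong ℕ.suc (ℕ.+-suc j _))))) j<p-1

    -- The exponents run from p - 1 to below 2 (p - 1), so only the constant term Aᴺ meets a
    -- multiple of p - 1, with power sum -1.
    T-p-1 : ∀ N → N ℕ.+ N ℕ.< p-1 → T N p-1 ≈ - (A ^ N)
    T-p-1 ℕ.zero    _       = ≈-trans (∑ₚ-cong λ a → ≡⇒≈ (*-identityʳ (a ^ p-1))) ∑-^p-1
    T-p-1 (ℕ.suc N) 2N+2<p-1 = begin
      T (ℕ.suc N) p-1                     ≈⟨ T-suc N p-1 ⟩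
      A * T N p-1 + B * T N (1 ℕ.+ p-1) + C * T N (2 ℕ.+ p-1)
        ≈⟨ combine (T-p-1 N (ℕ.<-trans (ℕ.n<1+n _) (ℕ.<-trans (ℕ.n<1+n _) bound)))
             (≈-trans (T-cong N (1 ℕ.+ p-1) 1 (^-period 0)) (T-low N 0 (ℕ.<-trans (ℕ.n<1+n _) bound)))
             (≈-trans (T-cong N (2 ℕ.+ p-1) 2 (^-period 1)) (T-low N 1 bound)) ⟩
      A * - (A ^ N) + B * 0ℤ + C * 0ℤ     ≡⟨ simplify A (A ^ N) B C ⟩
      - (A * A ^ N)                       ∎
      where
      simplify : ∀ a x b c → a * - x + b * 0ℤ + c * 0ℤ ≡ - (a * x)
      simplify = solve-∀
      bound : 2 ℕ.+ (N ℕ.+ N) ℕ.< p-1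
      bound = subst (ℕ._< p-1) (cong ℕ.suc (ℕ.+-suc N N)) 2N+2<p-1

    T-suc-p-2 : ∀ N → ℕ.suc (N ℕ.+ N) ℕ.< p-1 → T (ℕ.suc N) n ≈ A * T N n + B * - (A ^ N)
    T-suc-p-2 N 2N+1<p-1 = begin
      T (ℕ.suc N) n                                  ≈⟨ T-suc N n ⟩
      A * T N n + B * T N p-1 + C * T N (1 ℕ.+ p-1)
        ≈⟨ combine ≈-refl (T-p-1 N (ℕ.<-trans (ℕ.n<1+n _) 2N+1<p-1))
             (≈-trans (T-cong N (1 ℕ.+ p-1) 1 (^-period 0)) (T-low N 0 2N+1<p-1)) ⟩
      A * T N n + B * - (A ^ N) + C * 0ℤ             ≡⟨ trans (cong (_+_ (A * T N n + B * - (A ^ N))) (*-zeroʳ C)) (+-identityʳ _) ⟩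
      A * T N n + B * - (A ^ N)                      ∎

    -- Now the linear coefficient (N + 1) Aᴺ B is the one that meets a^(p-1). The bound keeps the
    -- top exponent p - 2 + 2 (N + 1) below 2 (p - 1), the next one that would count.
    T-p-2 : ∀ N → ℕ.suc (N ℕ.+ N) ℕ.< p-1 → T (ℕ.suc N) n ≈ - (+ ℕ.suc N * A ^ N * B)
    T-p-2 ℕ.zero 1<p-1 = begin
      T 1 n                     ≈⟨ T-suc-p-2 0 1<p-1 ⟩
      A * T 0 n + B * - 1ℤ      ≈⟨ +-congʳ (B * - 1ℤ) (*-congˡ A
                                     (≈-trans (∑ₚ-cong λ a → ≡⇒≈ (*-identityʳ (a ^ n))) (∑-^ n (ℕ.n<1+n n)))) ⟩
      A * 0ℤ + B * - 1ℤ         ≡⟨ simplify A B ⟩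
      - (1ℤ * 1ℤ * B)           ∎
      where
      simplify : ∀ a b → a * 0ℤ + b * - 1ℤ ≡ - (1ℤ * 1ℤ * b)
      simplify = solve-∀
    T-p-2 (ℕ.suc N) 2N+3<p-1 = begin
      T (2 ℕ.+ N) n                                ≈⟨ T-suc-p-2 (ℕ.suc N) 2N+3<p-1 ⟩
      A * T (ℕ.suc N) n + B * - (A * A ^ N)        ≈⟨ +-congʳ (B * - (A * A ^ N)) (*-congˡ A (T-p-2 N bound)) ⟩
      A * - (+ ℕ.suc N * A ^ N * B) + B * - (A * A ^ N) ≡⟨ simplify A (+ ℕ.suc N) (A ^ N) B ⟩
      - ((1ℤ + + ℕ.suc N) * (A * A ^ N) * B)       ∎
      where
      simplify : ∀ a k x b → a * - (k * x * b) + b * - (a * x) ≡ - ((1ℤ + k) * (a * x) * b)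
      simplify = solve-∀
      bound : ℕ.suc (N ℕ.+ N) ℕ.< p-1
      bound = ℕ.<-trans (ℕ.n<1+n _) (ℕ.<-trans (ℕ.n<1+n _)
        (subst (ℕ._< p-1) (cong (λ x → 2 ℕ.+ x) (ℕ.+-suc N N)) 2N+3<p-1))

  -- The indicator of congruence, and sums grouped by value.

  ^-p : ∀ a → a ^ p ≈ a
  ^-p a = ≈-trans (^-period 0 a) (≡⇒≈ (*-identityʳ a))

  -- The sum of aⁱ bʲ over i + j = N, a form of (aᴺ⁺¹ - bᴺ⁺¹) / (a - b) that makes sense for a = b
  -- as well.
  geometric : ℕ → ℤ → ℤ → ℤ
  geometric ℕ.zero    a b = 1ℤ
  geometric (ℕ.suc N) a b = a ^ ℕ.suc N + b * geometric N a b

  geometric-difference : ∀ N a b → (a - b) * geometric N a b ≡ a ^ ℕ.suc N - b ^ ℕ.suc N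
  geometric-difference ℕ.zero    a b = base a b
    where
    base : ∀ a b → (a - b) * 1ℤ ≡ a * 1ℤ - b * 1ℤ
    base = solve-∀
  geometric-difference (ℕ.suc N) a b = trans
    (expand a b (a ^ ℕ.suc N) (geometric N a b))
    (trans (cong (λ x → (a - b) * a ^ ℕ.suc N + b * x) (geometric-difference N a b))
           (collect a b (a ^ ℕ.suc N) (b ^ ℕ.suc N)))
    where
    expand : ∀ a b x g → (a - b) * (x + b * g) ≡ (a - b) * x + b * ((a - b) * g)
    expand = solve-∀
    collect : ∀ a b x y → (a - b) * x + b * (x - y) ≡ a * x - b * y
    collect = solve-∀

  geometric-diagonal : ∀ N {a b} → a ≈ b → geometric N a b ≈ + ℕ.suc N * a ^ N
  geometric-diagonal ℕ.zero    a≈b = ≈-refl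
  geometric-diagonal (ℕ.suc N) {a} {b} a≈b = begin
    a * a ^ N + b * geometric N a b         ≈⟨ +-congˡ (a * a ^ N) (*-cong (≈-sym a≈b) (geometric-diagonal N a≈b)) ⟩
    a * a ^ N + a * (+ ℕ.suc N * a ^ N)     ≡⟨ collect a (a ^ N) (+ ℕ.suc N) ⟩
    (1ℤ + + ℕ.suc N) * (a * a ^ N)          ∎
    where
    collect : ∀ a x k → a * x + a * (k * x) ≡ (1ℤ + k) * (a * x)
    collect = solve-∀

  -- Equivalently, all binomial coefficients C(p-1, i) are ±1 modulo p, with alternating signs.
  difference-^p-1 : ∀ a b → (a - b) ^ p-1 ≈ geometric p-1 a b
  difference-^p-1 a b with a ≈? b
  -- For a ≈ b all p terms of the geometric sum coincide, so it vanishes like the left side.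
  ... | yes a≈b = begin
    (a - b) ^ p-1       ≈⟨ 0^suc n (≈-trans (+-congʳ (- b) a≈b) (≡⇒≈ (+-inverseʳ b))) ⟩
    0ℤ                  ≡⟨ *-zeroˡ (a ^ p-1) ⟨
    0ℤ * a ^ p-1        ≈⟨ *-congʳ (a ^ p-1) p≈0 ⟨
    + p * a ^ p-1       ≈⟨ geometric-diagonal p-1 a≈b ⟨
    geometric p-1 a b   ∎
  -- Once multiplied by a - b, both sides are a - b, by Fermat in the form aᵖ ≈ a.
  ... | no a≉b = *-cancelˡ {a - b} a-b≉0 (begin
    (a - b) * (a - b) ^ p-1        ≈⟨ ^-p (a - b) ⟩
    a - b                          ≈⟨ +-cong (^-p a) (-‿cong (^-p b)) ⟨
    a ^ p - b ^ p                  ≡⟨ geometric-difference p-1 a b ⟨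
    (a - b) * geometric p-1 a b    ∎)
    where
    a-b≉0 : a - b ≉ 0ℤ
    a-b≉0 = a≉b ∘ difference≈0

  -- By Fermat this is 1 if a ≈ b and 0 otherwise; as a polynomial expression it is accessible to
  -- power sums.
  δ : ℤ → ℤ → ℤ
  δ a b = 1ℤ + -1ℤ * (a - b) ^ p-1

  δ-wd : ∀ {a a′ b b′} → a ≈ a′ → b ≈ b′ → δ a b ≈ δ a′ b′
  δ-wd a≈a′ b≈b′ = +-congˡ 1ℤ (*-congˡ -1ℤ (^-cong p-1 (+-cong a≈a′ (-‿cong b≈b′))))

  δ-≈ : ∀ {a b} → a ≈ b → δ a b ≈ 1ℤ
  δ-≈ {a} {b} a≈b = +-congˡ 1ℤ (*-congˡ -1ℤ (0^suc n (≈-trans (+-congʳ (- b) a≈b) (≡⇒≈ (+-inverseʳ b)))))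

  δ-≉ : ∀ {a b} → a ≉ b → δ a b ≈ 0ℤ
  δ-≉ a≉b = +-congˡ 1ℤ (*-congˡ -1ℤ (fermat (a≉b ∘ difference≈0)))

  ∑ₚ-zero : ∀ {f} → (∀ a → f a ≈ 0ℤ) → ∑ₚ f ≈ 0ℤ
  ∑ₚ-zero f≈0 = ≈-trans (∑ₚ-cong f≈0) (≡⇒≈ (∑ₚ-*ˡ 0ℤ (λ _ → 0ℤ)))

  ∑ₚˣ-zero : ∀ {f} → (∀ a → a ≉ 0ℤ → f a ≈ 0ℤ) → ∑ₚˣ f ≈ 0ℤ
  ∑ₚˣ-zero f≈0 = ≈-trans (∑ₚˣ-cong f≈0) (≡⇒≈ (∑ₚˣ-*ˡ 0ℤ (λ _ → 0ℤ)))

  ∑ₚ-δ : ∀ {f} → WellDefined f → ∀ a → ∑ₚ (λ b → δ a b * f b) ≈ f a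
  ∑ₚ-δ {f} f-wd a = begin
    ∑ₚ (λ b → δ a b * f b)                 ≈⟨ ∑ₚ-shift (λ b≈c → *-cong (δ-wd (≈-refl {a}) b≈c) (f-wd b≈c)) a ⟨
    ∑ₚ (λ b → δ a (b + a) * f (b + a))     ≡⟨ ∑ₚ-split (λ b → δ a (b + a) * f (b + a)) ⟩
    δ a (0ℤ + a) * f (0ℤ + a) + ∑ₚˣ (λ b → δ a (b + a) * f (b + a))
      ≈⟨ +-cong (*-cong (δ-≈ (≡⇒≈ (sym (+-identityˡ a)))) (f-wd (≡⇒≈ (+-identityˡ a))))
                (∑ₚˣ-zero λ b b≉0 → *-congʳ (f (b + a)) (δ-≉ {a} {b + a} λ a≈b+a → b≉0 (vanish b a≈b+a))) ⟩
    1ℤ * f a + 0ℤ                          ≡⟨ trans (+-identityʳ (1ℤ * f a)) (*-identityˡ (f a)) ⟩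
    f a                                    ∎
    where
    vanish : ∀ b → a ≈ b + a → b ≈ 0ℤ
    vanish b a≈b+a = ≈-sym (+-cancelˡ {a} (≈-trans (≡⇒≈ (+-identityʳ a)) (≈-trans a≈b+a (≡⇒≈ (+-comm b a)))))

  -- Collecting the terms of a sum according to the value s of g.
  ∑ₚˣ-fibres : ∀ (w g : ℤ → ℤ) (count : ℤ → ℤ) →
               (∀ s → ∑ₚˣ (λ t → w t * δ (g t) s) ≈ count s) →
               ∀ {F} → WellDefined F → ∑ₚˣ (λ t → w t * F (g t)) ≈ ∑ₚ (λ s → F s * count s)
  ∑ₚˣ-fibres w g count fibre {F} F-wd = begin
    ∑ₚˣ (λ t → w t * F (g t))
      ≈⟨ ∑ₚˣ-cong (λ t _ → *-congˡ (w t) (∑ₚ-δ F-wd (g t))) ⟨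
    ∑ₚˣ (λ t → w t * ∑ₚ (λ s → δ (g t) s * F s))
      ≈⟨ ∑ₚˣ-cong (λ t _ → ≡⇒≈ (∑ₚ-*ˡ (w t) (λ s → δ (g t) s * F s))) ⟨
    ∑ₚˣ (λ t → ∑ₚ (λ s → w t * (δ (g t) s * F s)))
      ≡⟨ ∑ₚˣ-∑ₚ-comm (λ t s → w t * (δ (g t) s * F s)) ⟩
    ∑ₚ (λ s → ∑ₚˣ (λ t → w t * (δ (g t) s * F s)))
      ≈⟨ ∑ₚ-cong (λ s → ≈-trans (∑ₚˣ-cong λ t _ → ≡⇒≈ (rearrange (w t) (δ (g t) s) (F s)))
                               (≡⇒≈ (∑ₚˣ-*ˡ (F s) (λ t → w t * δ (g t) s)))) ⟩
    ∑ₚ (λ s → F s * ∑ₚˣ (λ t → w t * δ (g t) s))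
      ≈⟨ ∑ₚ-cong (λ s → *-congˡ (F s) (fibre s)) ⟩
    ∑ₚ (λ s → F s * count s) ∎
    where
    rearrange : ∀ w d f → w * (d * f) ≡ f * (w * d)
    rearrange = solve-∀

-- Odd primes p = 2k + 3: Euler's criterion and the fibres of t + t⁻¹.

module OddPrime (k : ℕ) (p-prime : Prime (3 ℕ.+ (k ℕ.+ k))) where

  open PrimeField (ℕ.suc (k ℕ.+ k)) p-prime

  open import Relation.Binary.Reasoning.Setoid setoid

  n m : ℕ
  n = ℕ.suc (k ℕ.+ k)
  m = ℕ.suc k

  m+m≡p-1 : m ℕ.+ m ≡ p-1
  m+m≡p-1 = cong ℕ.suc (ℕ.+-suc k k)

  2m≈-1 : + m + + m ≈ -1ℤ
  2m≈-1 = ≈-trans (≡⇒≈ (cong +_ m+m≡p-1)) p-1≈-1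

  2≉0 : + 2 ≉ 0ℤ
  2≉0 = +suc≉0 (ℕ.s≤s (ℕ.s≤s (ℕ.s≤s ℕ.z≤n)))

  fermat-half : ∀ {a} → a ≉ 0ℤ → a ^ m * a ^ m ≈ 1ℤ
  fermat-half {a} a≉0 = begin
    a ^ m * a ^ m  ≡⟨ ^-distribˡ-+-* a m m ⟨
    a ^ (m ℕ.+ m)  ≡⟨ cong (a ^_) m+m≡p-1 ⟩
    a ^ p-1        ≈⟨ fermat a≉0 ⟩
    1ℤ             ∎

  square-^ : ∀ N a → (a * a) ^ N ≡ a ^ (N ℕ.+ N)
  square-^ N a = trans (^-distribʳ-* N a a) (sym (^-distribˡ-+-* a N N))

  -- By `difference-^p-1`, the sum of (a² - d)^(p-1) over a is the sum over i ≤ p - 1 of d^(p-1-i) ∑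
  -- a^(2i). Only i = m and i = p - 1 make 2i a positive multiple of p - 1; they contribute -dᵐ and
  -- -1. `Q` builds this up one i at a time, as in Horner's scheme.
  module SquarePowerSum (d : ℤ) where

    Q : ℕ → ℤ
    Q N = ∑ₚ (λ a → geometric N (a * a) d)

    Q-suc : ∀ N → Q (ℕ.suc N) ≡ ∑ₚ (λ a → (a * a) ^ ℕ.suc N) + d * Q N
    Q-suc N = trans (∑ₚ-+ (λ a → (a * a) ^ ℕ.suc N) (λ a → d * geometric N (a * a) d))
      (cong (_+_ (∑ₚ (λ a → (a * a) ^ ℕ.suc N))) (∑ₚ-*ˡ d (λ a → geometric N (a * a) d)))

    Q-step : ∀ N {x y} → ∑ₚ (λ a → a ^ (ℕ.suc N ℕ.+ ℕ.suc N)) ≈ x → Q N ≈ y → Q (ℕ.suc N) ≈ x + d * y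
    Q-step N {x} {y} S≈x Q≈y = begin
      Q (ℕ.suc N)                                       ≡⟨ Q-suc N ⟩
      ∑ₚ (λ a → (a * a) ^ ℕ.suc N) + d * Q N
        ≈⟨ +-cong (≈-trans (∑ₚ-cong λ a → ≡⇒≈ (square-^ (ℕ.suc N) a)) S≈x) (*-congˡ d Q≈y) ⟩
      x + d * y                                         ∎

    Q-low : ∀ N → N ℕ.≤ k → Q N ≈ 0ℤ
    Q-low ℕ.zero    _   = ∑-^ 0 (ℕ.s≤s ℕ.z≤n)
    Q-low (ℕ.suc N) N<k = ≈-trans
      (Q-step N (∑-^ (ℕ.suc N ℕ.+ ℕ.suc N) (ℕ.s≤s (ℕ.≤-trans (ℕ.+-mono-≤ N<k N<k) (ℕ.n≤1+n (k ℕ.+ k)))))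
        (Q-low N (ℕ.<⇒≤ N<k)))
      (≡⇒≈ (trans (+-identityˡ (d * 0ℤ)) (*-zeroʳ d)))

    Q-high : ∀ i → i ℕ.≤ k → Q (i ℕ.+ m) ≈ - (d ^ i)
    Q-high ℕ.zero _ = ≈-trans
      (Q-step k (≈-trans (∑ₚ-cong λ a → ≡⇒≈ (cong (a ^_) m+m≡p-1)) ∑-^p-1) (Q-low k ℕ.≤-refl))
      (≡⇒≈ (cong (_+_ -1ℤ) (*-zeroʳ d)))
    Q-high (ℕ.suc i) i<k = ≈-trans
      (Q-step (i ℕ.+ m)
        (≈-trans (∑ₚ-cong λ a → ≈-trans (≡⇒≈ (cong (a ^_) exponent)) (^-period (i ℕ.+ ℕ.suc i) a))
          (∑-^ (ℕ.suc i ℕ.+ ℕ.suc i) (ℕ.s≤s (ℕ.≤-trans (ℕ.+-mono-≤ i<k i<k) (ℕ.n≤1+n (k ℕ.+ k))))))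
        (Q-high i (ℕ.<⇒≤ i<k)))
      (≡⇒≈ (simplify d (d ^ i)))
      where
      simplify : ∀ d x → 0ℤ + d * - x ≡ - (d * x)
      simplify = solve-∀
      regroup : ∀ i m → (ℕ.suc i ℕ.+ m) ℕ.+ (ℕ.suc i ℕ.+ m) ≡ (ℕ.suc i ℕ.+ ℕ.suc i) ℕ.+ (m ℕ.+ m)
      regroup = ℕ-Solver.solve-∀
      exponent : ℕ.suc (i ℕ.+ m) ℕ.+ ℕ.suc (i ℕ.+ m) ≡ (ℕ.suc i ℕ.+ ℕ.suc i) ℕ.+ p-1
      exponent = trans (regroup i m) (cong (λ x → (ℕ.suc i ℕ.+ ℕ.suc i) ℕ.+ x) m+m≡p-1)

    ∑-difference-squares : ∑ₚ (λ a → (a * a - d) ^ p-1) ≈ -1ℤ - d ^ m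
    ∑-difference-squares = begin
      ∑ₚ (λ a → (a * a - d) ^ p-1)   ≈⟨ ∑ₚ-cong (λ a → difference-^p-1 (a * a) d) ⟩
      Q p-1                          ≡⟨ cong (λ x → Q (ℕ.suc x)) (ℕ.+-suc k k) ⟨
      Q (ℕ.suc (k ℕ.+ m))            ≈⟨ Q-step (k ℕ.+ m) last-power (Q-high k ℕ.≤-refl) ⟩
      -1ℤ + d * - (d ^ k)            ≡⟨ simplify d (d ^ k) ⟩
      -1ℤ - d ^ m                    ∎
      where
      simplify : ∀ d x → -1ℤ + d * - x ≡ -1ℤ - d * x
      simplify = solve-∀
      last-power : ∑ₚ (λ a → a ^ ((m ℕ.+ m) ℕ.+ (m ℕ.+ m))) ≈ -1ℤ
      last-power = ≈-trans (∑ₚ-cong λ a → ≈-trans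
        (≡⇒≈ (cong₂ (λ x y → a ^ (x ℕ.+ y)) m+m≡p-1 m+m≡p-1)) (^-period n a)) ∑-^p-1

  -- The constant part of `δ` sums to p ≈ 0, so the count is minus the sum of (a² - d)^(p-1).
  count-square-roots : ∀ d → ∑ₚ (λ a → δ (a * a) d) ≈ 1ℤ + d ^ m
  count-square-roots d = begin
    ∑ₚ (λ a → 1ℤ + -1ℤ * (a * a - d) ^ p-1)
      ≡⟨ trans (∑ₚ-+ (λ _ → 1ℤ) (λ a → -1ℤ * (a * a - d) ^ p-1))
           (cong (_+_ (∑ₚ (λ _ → 1ℤ))) (∑ₚ-*ˡ -1ℤ (λ a → (a * a - d) ^ p-1))) ⟩
    ∑ₚ (λ _ → 1ℤ) + -1ℤ * ∑ₚ (λ a → (a * a - d) ^ p-1)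
      ≈⟨ +-cong (∑-^ 0 (ℕ.s≤s ℕ.z≤n)) (*-congˡ -1ℤ (SquarePowerSum.∑-difference-squares d)) ⟩
    0ℤ + -1ℤ * (-1ℤ - d ^ m)
      ≡⟨ simplify (d ^ m) ⟩
    1ℤ + d ^ m ∎
    where
    simplify : ∀ x → 0ℤ + -1ℤ * (-1ℤ - x) ≡ 1ℤ + x
    simplify = solve-∀

  -- A nonresidue d has no square roots, so counting them modulo p gives 1 + dᵐ ≈ 0.
  euler-criterion : ∀ d → legendre d p ≈ d ^ m
  euler-criterion d = decide (d ≡? 0ℤ [mod p ]) (any? {n = p} λ x → (+ toℕ x) ^ 2 ≡? d [mod p ])
    where
    root : ∀ {a} → a ^ 2 ≈ d → d ≉ 0ℤ → 1ℤ ≈ d ^ m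
    root {a} a²≈d d≉0 = begin
      1ℤ             ≈⟨ fermat-half a≉0 ⟨
      a ^ m * a ^ m  ≡⟨ ^-distribʳ-* m a a ⟨
      (a * a) ^ m    ≈⟨ ^-cong m aa≈d ⟩
      d ^ m          ∎
      where
      aa≈d : a * a ≈ d
      aa≈d = ≈-trans (≡⇒≈ (cong (a *_) (sym (*-identityʳ a)))) a²≈d
      a≉0 : a ≉ 0ℤ
      a≉0 a≈0 = d≉0 (≈-trans (≈-sym aa≈d) (*-congʳ a a≈0))
    no-root : (∀ a → a * a ≉ d) → -1ℤ ≈ d ^ m
    no-root aa≉d = +-cancelˡ {1ℤ} (≈-trans (≈-sym (∑ₚ-zero λ a → δ-≉ (aa≉d a))) (count-square-roots d))
    decide : (d≟0 : Dec (d ≡ 0ℤ [mod p ])) (root? : Dec (∃[ x ] (+ toℕ {p} x) ^ 2 ≡ d [mod p ])) →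
             (if does d≟0 then 0ℤ else if does root? then 1ℤ else -1ℤ) ≈ d ^ m
    decide (yes d≡0) _              = ≈-sym (0^suc k {d} ⟨ d≡0 ⟩)
    decide (no d≢0)  (yes (x , x²≡d)) = root {+ toℕ x} ⟨ x²≡d ⟩ (λ d≈0 → d≢0 (difference d≈0))
    decide (no d≢0)  (no ∄root)     = no-root λ a aa≈d → ∄root (residue a , difference (begin
      (+ toℕ (residue a)) ^ 2  ≈⟨ ^-cong 2 (residue-≈ a) ⟩
      a ^ 2                    ≡⟨ cong (a *_) (*-identityʳ a) ⟩
      a * a                    ≈⟨ aa≈d ⟩
      d                        ∎))

  inv-inv : ∀ a → inv (inv a) ≈ a
  inv-inv a with a ≈? 0ℤ
  ... | yes a≈0 = ≈-trans (0^suc (k ℕ.+ k) (0^suc (k ℕ.+ k) a≈0)) (≈-sym a≈0)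
  ... | no a≉0  = *-cancelˡ {inv a} inv≉0 (≈-trans (*-inv inv≉0) (≈-sym (≈-trans (≡⇒≈ (*-comm (inv a) a)) (*-inv a≉0))))
    where
    inv≉0 : inv a ≉ 0ℤ
    inv≉0 inv≈0 = 1≉0 (begin
      1ℤ         ≈⟨ *-inv a≉0 ⟨
      a * inv a  ≈⟨ *-congˡ a inv≈0 ⟩
      a * 0ℤ     ≡⟨ *-zeroʳ a ⟩
      0ℤ         ∎)

  ∑ₚˣ-inv : ∀ {f} → WellDefined f → ∑ₚˣ f ≈ ∑ₚˣ (λ a → f (inv a))
  ∑ₚˣ-inv {f} f-wd = ∑ₚˣ-from-∑ₚ f (λ a → f (inv a)) (f-wd (≈-sym (0^suc (k ℕ.+ k) ≈-refl)))
    (≈-sym (∑ₚ-substitute inv inv f-wd (^-cong n) (^-cong n) inv-inv inv-inv))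

  -- t + t⁻¹ = s amounts to (2t - s)² = s² - 4.
  count-fibre : ∀ s → ∑ₚˣ (λ t → δ (t + inv t) s) ≈ 1ℤ + (s * s - + 4) ^ m
  count-fibre s = begin
    ∑ₚˣ (λ t → δ (t + inv t) s)           ≈⟨ ∑ₚˣ-cong complete-square ⟩
    ∑ₚˣ (λ t → root (+ 2 * t))            ≈⟨ ∑ₚˣ≈∑ₚ (λ t → root (+ 2 * t)) (δ-≉ 0-no-root) ⟩
    ∑ₚ (λ t → root (+ 2 * t))             ≈⟨ ∑ₚ-scale root-wd 2≉0 ⟩
    ∑ₚ (λ t → root t)                     ≈⟨ ∑ₚ-shift (λ a≈b → δ-wd (*-cong a≈b a≈b) ≈-refl) (- s) ⟩
    ∑ₚ (λ a → δ (a * a) d)                ≈⟨ count-square-roots d ⟩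
    1ℤ + d ^ m                            ∎
    where
    d = s * s - + 4
    root : ℤ → ℤ
    root a = δ ((a + - s) * (a + - s)) d
    root-wd : WellDefined root
    root-wd a≈b = δ-wd (*-cong (+-congʳ (- s) a≈b) (+-congʳ (- s) a≈b)) ≈-refl
    4≉0 : + 2 * + 2 ≉ 0ℤ
    4≉0 = *-nonzero 2≉0 2≉0
    -- The sum over t ≠ 0 may be completed to all residues because t = 0 is no solution: s² and s² -
    -- 4 differ by the unit 4.
    0-no-root : (0ℤ + - s) * (0ℤ + - s) ≉ d
    0-no-root ss≈d = 4≉0 (+-cancelˡ {d} (≈-trans (≡⇒≈ (expand s)) (≈-trans ss≈d (≡⇒≈ (sym (+-identityʳ d))))))
      where
      expand : ∀ s → (s * s - + 4) + + 2 * + 2 ≡ (0ℤ + - s) * (0ℤ + - s)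
      expand = solve-∀
    -- Inserting (4t)^(p-1) ≈ 1 clears the denominator inside the power that defines `δ`.
    complete-square : ∀ t → t ≉ 0ℤ → δ (t + inv t) s ≈ root (+ 2 * t)
    complete-square t t≉0 = +-congˡ 1ℤ (*-congˡ -1ℤ (begin
      (t + inv t - s) ^ p-1                              ≡⟨ *-identityˡ _ ⟨
      1ℤ * (t + inv t - s) ^ p-1                         ≈⟨ *-congʳ ((t + inv t - s) ^ p-1) (fermat (*-nonzero 4≉0 t≉0)) ⟨
      (+ 2 * + 2 * t) ^ p-1 * (t + inv t - s) ^ p-1      ≡⟨ ^-distribʳ-* p-1 (+ 2 * + 2 * t) (t + inv t - s) ⟨
      (+ 2 * + 2 * t * (t + inv t - s)) ^ p-1            ≈⟨ ^-cong p-1 (begin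
          + 2 * + 2 * t * (t + inv t - s)                   ≡⟨ expand t (inv t) s ⟩
          + 4 * (t * inv t) + (+ 4 * (t * t) - + 4 * (t * s)) ≈⟨ +-congʳ (+ 4 * (t * t) - + 4 * (t * s)) (*-congˡ (+ 4) (*-inv t≉0)) ⟩
          + 4 * 1ℤ + (+ 4 * (t * t) - + 4 * (t * s))          ≡⟨ collect t s ⟩
          (+ 2 * t + - s) * (+ 2 * t + - s) - d             ∎) ⟩
      ((+ 2 * t + - s) * (+ 2 * t + - s) - d) ^ p-1      ∎))
      where
      expand : ∀ t u s → + 2 * + 2 * t * (t + u - s) ≡ + 4 * (t * u) + (+ 4 * (t * t) - + 4 * (t * s))
      expand = solve-∀
      collect : ∀ t s → + 4 * 1ℤ + (+ 4 * (t * t) - + 4 * (t * s)) ≡ (+ 2 * t + - s) * (+ 2 * t + - s) - (s * s - + 4)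
      collect = solve-∀

  -- With ε = ±1, t (t + t⁻¹ + 2ε) = (t + ε)² makes t and s + 2ε agree up to a square.
  count-fibre-twisted′ : ∀ ε → ε * ε ≡ 1ℤ → ∀ s → s + + 2 * ε ≉ 0ℤ →
    ∑ₚˣ (λ t → t ^ m * δ (t + inv t) s) ≈ (s + + 2 * ε) ^ m + (s - + 2 * ε) ^ m
  count-fibre-twisted′ ε εε≡1 s s+2ε≉0 = begin
    ∑ₚˣ (λ t → t ^ m * δ (t + inv t) s)        ≈⟨ ∑ₚˣ-cong twist ⟩
    ∑ₚˣ (λ t → r ^ m * δ (t + inv t) s)        ≡⟨ ∑ₚˣ-*ˡ (r ^ m) (λ t → δ (t + inv t) s) ⟩
    r ^ m * ∑ₚˣ (λ t → δ (t + inv t) s)        ≈⟨ *-congˡ (r ^ m) (count-fibre s) ⟩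
    r ^ m * (1ℤ + (s * s - + 4) ^ m)           ≡⟨ cong (λ x → r ^ m * (1ℤ + x)) (trans (cong (_^ m) factor) (^-distribʳ-* m r r′)) ⟩
    r ^ m * (1ℤ + r ^ m * r′ ^ m)              ≡⟨ expand (r ^ m) (r′ ^ m) ⟩
    r ^ m + (r ^ m * r ^ m) * r′ ^ m           ≈⟨ +-congˡ (r ^ m) (*-congʳ (r′ ^ m) (fermat-half s+2ε≉0)) ⟩
    r ^ m + 1ℤ * r′ ^ m                        ≡⟨ cong (_+_ (r ^ m)) (*-identityˡ (r′ ^ m)) ⟩
    r ^ m + r′ ^ m                             ∎
    where
    r = s + + 2 * ε
    r′ = s - + 2 * ε
    expand : ∀ x y → x * (1ℤ + x * y) ≡ x + (x * x) * y
    expand = solve-∀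
    factor′ : ∀ s ε → s * s - + 4 * (ε * ε) ≡ (s + + 2 * ε) * (s - + 2 * ε)
    factor′ = solve-∀
    factor : s * s - + 4 ≡ r * r′
    factor = trans (cong (λ x → s * s - + 4 * x) (sym εε≡1)) (factor′ s ε)
    twist : ∀ t → t ≉ 0ℤ → t ^ m * δ (t + inv t) s ≈ r ^ m * δ (t + inv t) s
    twist t t≉0 with (t + inv t) ≈? s
    ... | no g≉s = ≈-trans (*-congˡ (t ^ m) (δ-≉ g≉s)) (≈-trans (≡⇒≈ (trans (*-zeroʳ (t ^ m)) (sym (*-zeroʳ (r ^ m)))))
                     (*-congˡ (r ^ m) (≈-sym (δ-≉ g≉s))))
    ... | yes g≈s = *-congʳ (δ (t + inv t) s) (begin
      t ^ m                                ≡⟨ *-identityʳ (t ^ m) ⟨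
      t ^ m * 1ℤ                           ≈⟨ *-congˡ (t ^ m) (fermat-half t+ε≉0) ⟨
      t ^ m * ((t + ε) ^ m * (t + ε) ^ m)  ≡⟨ cong (t ^ m *_) (^-distribʳ-* m (t + ε) (t + ε)) ⟨
      t ^ m * ((t + ε) * (t + ε)) ^ m      ≈⟨ *-congˡ (t ^ m) (^-cong m tr≈square) ⟨
      t ^ m * (t * r) ^ m                  ≡⟨ cong (t ^ m *_) (^-distribʳ-* m t r) ⟩
      t ^ m * (t ^ m * r ^ m)              ≡⟨ *-assoc (t ^ m) (t ^ m) (r ^ m) ⟨
      t ^ m * t ^ m * r ^ m                ≈⟨ *-congʳ (r ^ m) (fermat-half t≉0) ⟩
      1ℤ * r ^ m                           ≡⟨ *-identityˡ (r ^ m) ⟩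
      r ^ m                                ∎)
      where
      open-up : ∀ t u e → t * (t + u + + 2 * e) ≡ t * u + (t * t + + 2 * e * t)
      open-up = solve-∀
      square : ∀ t e → e * e + (t * t + + 2 * e * t) ≡ (t + e) * (t + e)
      square = solve-∀
      tr≈square : t * r ≈ (t + ε) * (t + ε)
      tr≈square = begin
        t * r                               ≈⟨ *-congˡ t (+-congʳ (+ 2 * ε) g≈s) ⟨
        t * (t + inv t + + 2 * ε)           ≡⟨ open-up t (inv t) ε ⟩
        t * inv t + (t * t + + 2 * ε * t)   ≈⟨ +-congʳ (t * t + + 2 * ε * t) (*-inv t≉0) ⟩
        1ℤ + (t * t + + 2 * ε * t)          ≡⟨ cong (_+ (t * t + + 2 * ε * t)) εε≡1 ⟨
        ε * ε + (t * t + + 2 * ε * t)       ≡⟨ square t ε ⟩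
        (t + ε) * (t + ε)                   ∎
      t+ε≉0 : t + ε ≉ 0ℤ
      t+ε≉0 t+ε≈0 = *-nonzero t≉0 s+2ε≉0 (≈-trans tr≈square (*-congʳ (t + ε) t+ε≈0))

  -- As s + 2 and s - 2 differ by 4, they do not both vanish, so ε = 1 or ε = -1 is admissible; the
  -- right side is symmetric in the two choices.
  count-fibre-twisted : ∀ s → ∑ₚˣ (λ t → t ^ m * δ (t + inv t) s) ≈ (s + + 2) ^ m + (s - + 2) ^ m
  count-fibre-twisted s with (s + + 2) ≈? 0ℤ
  ... | no s+2≉0  = count-fibre-twisted′ 1ℤ refl s s+2≉0
  ... | yes s+2≈0 = ≈-trans (count-fibre-twisted′ -1ℤ refl s s-2≉0) (≡⇒≈ (+-comm ((s - + 2) ^ m) ((s + + 2) ^ m)))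
    where
    split : ∀ s → + 2 * + 2 + (s - + 2) ≡ s + + 2
    split = solve-∀
    s-2≉0 : s - + 2 ≉ 0ℤ
    s-2≉0 s-2≈0 = *-nonzero 2≉0 2≉0 (begin
      + 2 * + 2              ≡⟨ +-identityʳ (+ 2 * + 2) ⟨
      + 2 * + 2 + 0ℤ         ≈⟨ +-congˡ (+ 2 * + 2) s-2≈0 ⟨
      + 2 * + 2 + (s - + 2)  ≡⟨ split s ⟩
      s + + 2                ≈⟨ s+2≈0 ⟩
      0ℤ                     ∎)

  -- The eigenvalues μᵣ and their eigenvectors.

  module Eigenvalues (c : ℤ) where

    F : ℤ → ℤ
    F s = (s + c) ^ n

    F-wd : WellDefined F
    F-wd s≈s′ = ^-cong n (+-congʳ c s≈s′)

    μ : ℕ → ℤ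
    μ r = ∑ₚˣ (λ t → t ^ r * F (t + inv t))

    -- In the variable u = s + c the factor `F s` is u^(p-2), which picks out the linear coefficient
    -- m Aᵏ (-2c) of ((u - c)² - 4)ᵐ; then 2m ≈ -1 absorbs the constant. The summand 1 of the fibre
    -- count gives the power sum of exponent p - 2, which is 0.
    μ₀ : μ 0 ≈ - (c * (c * c - + 4) ^ k)
    μ₀ = begin
      μ 0                                                 ≈⟨ ∑ₚˣ-fibres (_^ 0) (λ t → t + inv t) (λ s → 1ℤ + (s * s - + 4) ^ m)
                                                               (λ s → ≈-trans (∑ₚˣ-cong λ t _ → ≡⇒≈ (*-identityˡ (δ (t + inv t) s))) (count-fibre s)) F-wd ⟩
      ∑ₚ (λ s → F s * (1ℤ + (s * s - + 4) ^ m))           ≈⟨ ∑ₚ-cong (λ s → ≡⇒≈ (trans (split (F s) ((s * s - + 4) ^ m))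
                                                               (cong (λ x → F s + F s * x ^ m) (recentre s c)))) ⟩
      ∑ₚ (λ s → f (s + c))                                ≈⟨ ∑ₚ-shift f-wd c ⟩
      ∑ₚ f                                                ≡⟨ ∑ₚ-+ (_^ n) (λ u → u ^ n * q u ^ m) ⟩
      ∑ₚ (_^ n) + T m n                                   ≈⟨ +-cong (∑-^ n (ℕ.n<1+n n)) (T-p-2 k (ℕ.n<1+n n)) ⟩
      0ℤ + - (+ m * A ^ k * (- + 2 * c))                  ≡⟨ double (+ m) (A ^ k) c ⟩
      (+ m + + m) * (c * A ^ k)                           ≈⟨ *-congʳ (c * A ^ k) 2m≈-1 ⟩
      -1ℤ * (c * A ^ k)                                   ≡⟨ -1*i≡-i (c * A ^ k) ⟩
      - (c * A ^ k)                                       ∎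
      where
      A = c * c - + 4
      open QuadraticSum A (- + 2 * c) 1ℤ
      f : ℤ → ℤ
      f u = u ^ n + u ^ n * q u ^ m
      f-wd : WellDefined f
      f-wd u≈v = +-cong (^-cong n u≈v) (*-cong (^-cong n u≈v) (^-cong m
        (+-cong (+-congˡ A (*-congˡ (- + 2 * c) u≈v)) (*-congˡ 1ℤ (*-cong u≈v u≈v)))))
      split : ∀ x y → x * (1ℤ + y) ≡ x + x * y
      split = solve-∀
      recentre : ∀ s c → s * s - + 4 ≡ c * c - + 4 + - + 2 * c * (s + c) + 1ℤ * ((s + c) * (s + c))
      recentre = solve-∀
      double : ∀ m x c → 0ℤ + - (m * x * (- + 2 * c)) ≡ (m + m) * (c * x)
      double = solve-∀

    -- The same shift makes the second factor (u + e - c)ᵐ, with linear coefficient m (e - c)ᵏ.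
    ∑-linear : ∀ e → ∑ₚ (λ s → F s * (s + e) ^ m) ≈ - (+ m * (e - c) ^ k)
    ∑-linear e = begin
      ∑ₚ (λ s → F s * (s + e) ^ m)       ≈⟨ ∑ₚ-cong (λ s → ≡⇒≈ (cong (λ x → F s * x ^ m) (recentre s c e))) ⟩
      ∑ₚ (λ s → f (s + c))               ≈⟨ ∑ₚ-shift f-wd c ⟩
      T m n                              ≈⟨ T-p-2 k (ℕ.n<1+n n) ⟩
      - (+ m * (e - c) ^ k * 1ℤ)         ≡⟨ cong -_ (*-identityʳ (+ m * (e - c) ^ k)) ⟩
      - (+ m * (e - c) ^ k)              ∎
      where
      open QuadraticSum (e - c) 1ℤ 0ℤ
      f : ℤ → ℤ
      f u = u ^ n * q u ^ m
      f-wd : WellDefined f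
      f-wd u≈v = *-cong (^-cong n u≈v) (^-cong m
        (+-cong (+-congˡ (e - c) (*-congˡ 1ℤ u≈v)) (*-congˡ 0ℤ (*-cong u≈v u≈v))))
      recentre : ∀ s c e → s + e ≡ e - c + 1ℤ * (s + c) + 0ℤ * ((s + c) * (s + c))
      recentre = solve-∀

    μₘ : μ m ≈ - (+ m * ((+ 2 - c) ^ k + (- + 2 - c) ^ k))
    μₘ = begin
      μ m                                                 ≈⟨ ∑ₚˣ-fibres (_^ m) (λ t → t + inv t) (λ s → (s + + 2) ^ m + (s - + 2) ^ m)
                                                               count-fibre-twisted F-wd ⟩
      ∑ₚ (λ s → F s * ((s + + 2) ^ m + (s - + 2) ^ m))
        ≈⟨ ∑ₚ-cong (λ s → ≡⇒≈ (*-distribˡ-+ (F s) ((s + + 2) ^ m) ((s - + 2) ^ m))) ⟩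
      ∑ₚ (λ s → F s * (s + + 2) ^ m + F s * (s - + 2) ^ m)
        ≡⟨ ∑ₚ-+ (λ s → F s * (s + + 2) ^ m) (λ s → F s * (s - + 2) ^ m) ⟩
      ∑ₚ (λ s → F s * (s + + 2) ^ m) + ∑ₚ (λ s → F s * (s - + 2) ^ m)
        ≈⟨ +-cong (∑-linear (+ 2)) (∑-linear (- + 2)) ⟩
      - (+ m * (+ 2 - c) ^ k) + - (+ m * (- + 2 - c) ^ k)
        ≡⟨ collect (+ m) ((+ 2 - c) ^ k) ((- + 2 - c) ^ k) ⟩
      - (+ m * ((+ 2 - c) ^ k + (- + 2 - c) ^ k)) ∎
      where
      collect : ∀ m x y → - (m * x) + - (m * y) ≡ - (m * (x + y))
      collect = solve-∀

    μ-symmetric : ∀ i j → i ℕ.+ j ≡ p-1 → μ i ≈ μ j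
    μ-symmetric i j i+j≡p-1 = ≈-trans (∑ₚˣ-inv f-wd) (∑ₚˣ-cong λ t t≉0 →
      *-cong (power t t≉0) (F-wd (≈-trans (+-congˡ (inv t) (inv-inv t)) (≡⇒≈ (+-comm (inv t) t)))))
      where
      f-wd : WellDefined (λ t → t ^ i * F (t + inv t))
      f-wd t≈u = *-cong (^-cong i t≈u) (F-wd (+-cong t≈u (^-cong n t≈u)))
      power : ∀ t → t ≉ 0ℤ → inv t ^ i ≈ t ^ j
      power t t≉0 = begin
        inv t ^ i                      ≡⟨ *-identityʳ (inv t ^ i) ⟨
        inv t ^ i * 1ℤ                 ≈⟨ *-congˡ (inv t ^ i) (fermat t≉0) ⟨
        inv t ^ i * t ^ p-1            ≡⟨ cong (λ e → inv t ^ i * t ^ e) i+j≡p-1 ⟨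
        inv t ^ i * t ^ (i ℕ.+ j)      ≡⟨ cong (inv t ^ i *_) (^-distribˡ-+-* t i j) ⟩
        inv t ^ i * (t ^ i * t ^ j)    ≡⟨ rotate (inv t ^ i) (t ^ i) (t ^ j) ⟩
        t ^ i * inv t ^ i * t ^ j      ≡⟨ cong (_* t ^ j) (^-distribʳ-* i t (inv t)) ⟨
        (t * inv t) ^ i * t ^ j        ≈⟨ *-congʳ (t ^ j) (^-cong i (*-inv t≉0)) ⟩
        1ℤ ^ i * t ^ j                 ≡⟨ trans (cong (_* t ^ j) (^-zeroˡ i)) (*-identityˡ (t ^ j)) ⟩
        t ^ j                          ∎
        where
        rotate : ∀ x y z → x * (y * z) ≡ y * x * z
        rotate = solve-∀

    entry : ℤ → ℤ → ℤ
    entry x y = (x ^ 2 + c * x * y + y ^ 2) ^ n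

    -- With y = x t the quadratic form is x² t (t + t⁻¹ + c). Its n-th power yields x^(2n) = x^(2k)
    -- x^(p-1) and tⁿ, and one factor t of (x t)^(r+1) completes tⁿ to t^(p-1) ≈ 1; hence the
    -- exponents r + 1 rather than r.
    eigenvector : ∀ r {x} → x ≉ 0ℤ →
                  ∑ₚˣ (λ y → entry x y * y ^ ℕ.suc r) ≈ x ^ (k ℕ.+ k) * (x ^ ℕ.suc r * μ r)
    eigenvector r {x} x≉0 = begin
      ∑ₚˣ (λ y → entry x y * y ^ ℕ.suc r)                    ≈⟨ ∑ₚˣ-scale f-wd x≉0 ⟩
      ∑ₚˣ (λ t → entry x (x * t) * (x * t) ^ ℕ.suc r)        ≈⟨ ∑ₚˣ-cong term ⟩
      ∑ₚˣ (λ t → x ^ (k ℕ.+ k) * x ^ ℕ.suc r * (t ^ r * F (t + inv t)))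
        ≡⟨ ∑ₚˣ-*ˡ (x ^ (k ℕ.+ k) * x ^ ℕ.suc r) (λ t → t ^ r * F (t + inv t)) ⟩
      x ^ (k ℕ.+ k) * x ^ ℕ.suc r * μ r                      ≡⟨ *-assoc (x ^ (k ℕ.+ k)) (x ^ ℕ.suc r) (μ r) ⟩
      x ^ (k ℕ.+ k) * (x ^ ℕ.suc r * μ r)                    ∎
      where
      f-wd : WellDefined (λ y → entry x y * y ^ ℕ.suc r)
      f-wd y≈z = *-cong (^-cong n (+-cong (+-congˡ (x ^ 2) (*-congˡ (c * x) y≈z)) (^-cong 2 y≈z))) (^-cong (ℕ.suc r) y≈z)
      expand : ∀ c x t → x * (x * 1ℤ) + c * x * (x * t) + x * t * (x * t * 1ℤ) ≡ x * x * (1ℤ + (c * t + t * t))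
      expand = solve-∀
      collect : ∀ c x t u → x * x * (t * u + (c * t + t * t)) ≡ x * (x * (t * (t + u + c)))
      collect = solve-∀
      rearrange : ∀ X T h y t w → X * (X * (T * h)) * (y * (t * w)) ≡ X * X * y * (t * T * (w * h))
      rearrange = solve-∀
      pull : ∀ x z → x * z * (x * z) ≡ z * (x * (x * z))
      pull = solve-∀
      quadratic : ∀ t → t ≉ 0ℤ → x ^ 2 + c * x * (x * t) + (x * t) ^ 2 ≈ x * (x * (t * (t + inv t + c)))
      quadratic t t≉0 = begin
        x ^ 2 + c * x * (x * t) + (x * t) ^ 2           ≡⟨ expand c x t ⟩
        x * x * (1ℤ + (c * t + t * t))                  ≈⟨ *-congˡ (x * x) (+-congʳ (c * t + t * t) (*-inv t≉0)) ⟨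
        x * x * (t * inv t + (c * t + t * t))           ≡⟨ collect c x t (inv t) ⟩
        x * (x * (t * (t + inv t + c)))                 ∎
      distribute : ∀ a b d → (a * (a * (b * d))) ^ n ≡ a ^ n * (a ^ n * (b ^ n * d ^ n))
      distribute a b d = trans (^-distribʳ-* n a (a * (b * d))) (cong (a ^ n *_)
        (trans (^-distribʳ-* n a (b * d)) (cong (a ^ n *_) (^-distribʳ-* n b d))))
      term : ∀ t → t ≉ 0ℤ → entry x (x * t) * (x * t) ^ ℕ.suc r ≈ x ^ (k ℕ.+ k) * x ^ ℕ.suc r * (t ^ r * F (t + inv t))
      term t t≉0 = begin
        entry x (x * t) * (x * t) ^ ℕ.suc r
          ≈⟨ *-cong (≈-trans (^-cong n (quadratic t t≉0)) (≡⇒≈ (distribute x t (t + inv t + c))))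
                    (≡⇒≈ (^-distribʳ-* (ℕ.suc r) x t)) ⟩
        x ^ n * (x ^ n * (t ^ n * F (t + inv t))) * (x ^ ℕ.suc r * (t * t ^ r))
          ≡⟨ rearrange (x ^ n) (t ^ n) (F (t + inv t)) (x ^ ℕ.suc r) t (t ^ r) ⟩
        x ^ n * x ^ n * x ^ ℕ.suc r * (t ^ p-1 * (t ^ r * F (t + inv t)))
          ≡⟨ cong (λ z → z * x ^ ℕ.suc r * (t ^ p-1 * (t ^ r * F (t + inv t)))) (pull x (x ^ (k ℕ.+ k))) ⟩
        x ^ (k ℕ.+ k) * x ^ p-1 * x ^ ℕ.suc r * (t ^ p-1 * (t ^ r * F (t + inv t)))
          ≈⟨ *-cong (*-congʳ (x ^ ℕ.suc r) (*-congˡ (x ^ (k ℕ.+ k)) (fermat x≉0)))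
                    (*-congʳ (t ^ r * F (t + inv t)) (fermat t≉0)) ⟩
        x ^ (k ℕ.+ k) * 1ℤ * x ^ ℕ.suc r * (1ℤ * (t ^ r * F (t + inv t)))
          ≡⟨ cong₂ (λ a b → a * x ^ ℕ.suc r * b) (*-identityʳ (x ^ (k ℕ.+ k))) (*-identityˡ (t ^ r * F (t + inv t))) ⟩
        x ^ (k ℕ.+ k) * x ^ ℕ.suc r * (t ^ r * F (t + inv t)) ∎

  -- The first and the last factor agree and are stripped together as a square, until only the
  -- middle one is left.
  ∏<-palindrome : ∀ l (f : ℕ → ℤ) → (∀ i j → i ℕ.+ j ≡ l ℕ.+ l → f i ≈ f j) →
                  ∃[ z ] ∏< (ℕ.suc (l ℕ.+ l)) f ≈ f l * (z * z)
  ∏<-palindrome ℕ.zero    f sym-f = 1ℤ , ≈-refl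
  ∏<-palindrome (ℕ.suc l) f sym-f = f 0 * z , (begin
    ∏< (ℕ.suc (ℕ.suc l ℕ.+ ℕ.suc l)) f           ≡⟨ cong (λ N → ∏< (2 ℕ.+ N) f) (ℕ.+-suc l l) ⟩
    f 0 * ∏< (2 ℕ.+ (l ℕ.+ l)) g                 ≡⟨ cong (f 0 *_) (∏<-last (ℕ.suc (l ℕ.+ l)) g) ⟩
    f 0 * (∏< (ℕ.suc (l ℕ.+ l)) g * f (2 ℕ.+ (l ℕ.+ l)))
      ≈⟨ *-congˡ (f 0) (*-cong ∏g≈ (≈-sym (sym-f 0 (2 ℕ.+ (l ℕ.+ l)) (cong ℕ.suc (sym (ℕ.+-suc l l)))))) ⟩
    f 0 * (g l * (z * z) * f 0)                  ≡⟨ regroup (f 0) (g l) z ⟩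
    g l * (f 0 * z * (f 0 * z))                  ∎)
    where
    g : ℕ → ℤ
    g i = f (ℕ.suc i)
    shifted : ∀ {i j} → i ℕ.+ j ≡ l ℕ.+ l → ℕ.suc i ℕ.+ ℕ.suc j ≡ ℕ.suc l ℕ.+ ℕ.suc l
    shifted {i} {j} eq = cong ℕ.suc (trans (ℕ.+-suc i j) (trans (cong ℕ.suc eq) (sym (ℕ.+-suc l l))))
    inner = ∏<-palindrome l g (λ i j eq → sym-f (ℕ.suc i) (ℕ.suc j) (shifted eq))
    z = proj₁ inner
    ∏g≈ = proj₂ inner
    regroup : ∀ a b z → a * (b * (z * z) * a) ≡ b * (a * z * (a * z))
    regroup = solve-∀

  -- The matrix of powers and its inverse.

  x : Fin p-1 → ℤ
  x i = + ℕ.suc (toℕ i)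

  x≉0 : ∀ i → x i ≉ 0ℤ
  x≉0 i = +suc≉0 (ℕ.s≤s (toℕ<n i))

  -- Orthogonality of characters: n - s = p - 1 - (s + 1) is the exponent of the inverse character,
  -- and -1 is the reciprocal of p - 1 modulo p.
  W W⁻¹ : Matrix p-1
  W i r = x i ^ ℕ.suc (toℕ r)
  W⁻¹ s j = -1ℤ * x j ^ (n ℕ.∸ toℕ s)

  ∑ₚˣ-^ : ∀ j → ℕ.suc j ℕ.< p-1 → ∑ₚˣ (_^ ℕ.suc j) ≈ 0ℤ
  ∑ₚˣ-^ j j<p-1 = ≈-trans (∑ₚˣ≈∑ₚ (_^ ℕ.suc j) (0^suc j ≈-refl)) (∑-^ (ℕ.suc j) j<p-1)

  ∑ₚˣ-^-diagonal : ∀ s → s ℕ.≤ n → ∑ₚˣ (_^ (n ℕ.∸ s ℕ.+ ℕ.suc s)) ≈ -1ℤ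
  ∑ₚˣ-^-diagonal s s≤n = ≈-trans
    (∑ₚˣ-cong λ a a≉0 → ≈-trans (≡⇒≈ (cong (a ^_) (trans (ℕ.+-suc (n ℕ.∸ s) s) (cong ℕ.suc (ℕ.m∸n+n≡m s≤n)))))
                                (fermat a≉0)) ∑ₚˣ-1

  -- For s < r the exponent is p - 1 + (r - s) and drops by one period; for s > r it already lies
  -- strictly between 0 and p - 1. Either way the power sum vanishes.
  ∑ₚˣ-^-off-diagonal : ∀ s r → s ℕ.≤ n → r ℕ.≤ n → s ≢ r → ∑ₚˣ (_^ (n ℕ.∸ s ℕ.+ ℕ.suc r)) ≈ 0ℤ
  ∑ₚˣ-^-off-diagonal s r s≤n r≤n s≢r with ℕ.compare s r
  ... | ℕ.equal _     = contradiction refl s≢r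
  ... | ℕ.less _ d    = ≈-trans
    (∑ₚˣ-cong λ a a≉0 → ≈-trans (≡⇒≈ (cong (a ^_) exponent)) (^-period d a))
    (∑ₚˣ-^ d (ℕ.s≤s (ℕ.≤-trans (ℕ.s≤s (ℕ.m≤n+m d s)) r≤n)))
    where
    exponent : n ℕ.∸ s ℕ.+ (2 ℕ.+ (s ℕ.+ d)) ≡ ℕ.suc d ℕ.+ p-1
    exponent = trans (regroup (n ℕ.∸ s) s d) (cong (λ y → ℕ.suc d ℕ.+ ℕ.suc y) (ℕ.m∸n+n≡m s≤n))
      where
      regroup : ∀ a s d → a ℕ.+ (2 ℕ.+ (s ℕ.+ d)) ≡ ℕ.suc d ℕ.+ ℕ.suc (a ℕ.+ s)
      regroup = ℕ-Solver.solve-∀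
  ... | ℕ.greater _ d = ≈-trans
    (≡⇒≈ (cong (λ e → ∑ₚˣ (_^ e)) (ℕ.+-suc (n ℕ.∸ s) r)))
    (∑ₚˣ-^ (n ℕ.∸ s ℕ.+ r) (ℕ.s≤s (subst (ℕ._≤ n) (ℕ.+-suc (n ℕ.∸ s) r)
      (subst (n ℕ.∸ s ℕ.+ ℕ.suc r ℕ.≤_) (ℕ.m∸n+n≡m s≤n) (ℕ.+-monoʳ-≤ (n ℕ.∸ s) (ℕ.s≤s (ℕ.m≤m+n r d)))))))

  W⁻¹⊗W : ∀ s r → (W⁻¹ ⊗ W) s r ≈ 𝟙 s r
  W⁻¹⊗W s r = begin
    ∑[ j < p-1 ] (W⁻¹ s j * W j r)
      ≡⟨ sum-cong-≗ {p-1} (λ j → trans (*-assoc -1ℤ (x j ^ (n ℕ.∸ toℕ s)) (W j r))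
           (cong (-1ℤ *_) (sym (^-distribˡ-+-* (x j) (n ℕ.∸ toℕ s) (ℕ.suc (toℕ r)))))) ⟩
    ∑[ j < p-1 ] (-1ℤ * x j ^ e)      ≡⟨ ∑ₚˣ-Fin (λ a → -1ℤ * a ^ e) ⟨
    ∑ₚˣ (λ a → -1ℤ * a ^ e)           ≡⟨ ∑ₚˣ-*ˡ -1ℤ (_^ e) ⟩
    -1ℤ * ∑ₚˣ (_^ e)                  ≈⟨ evaluate (s ≟ r) ⟩
    𝟙 s r                             ∎
    where
    e = n ℕ.∸ toℕ s ℕ.+ ℕ.suc (toℕ r)
    ≤n : ∀ (i : Fin p-1) → toℕ i ℕ.≤ n
    ≤n i = ℕ.s≤s⁻¹ (toℕ<n i)
    evaluate : Dec (s ≡ r) → -1ℤ * ∑ₚˣ (_^ e) ≈ 𝟙 s r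
    evaluate (yes refl) = ≈-trans (*-congˡ -1ℤ (∑ₚˣ-^-diagonal (toℕ s) (≤n s))) (≡⇒≈ (sym (𝟙-diagonal s)))
    evaluate (no s≢r)   = ≈-trans
      (*-congˡ -1ℤ (∑ₚˣ-^-off-diagonal (toℕ s) (toℕ r) (≤n s) (≤n r) λ eq → s≢r (toℕ-injective eq)))
      (≡⇒≈ (sym (𝟙-off-diagonal s≢r)))

  det-W-invertible : det W⁻¹ * det W ≈ 1ℤ
  det-W-invertible = begin
    det W⁻¹ * det W  ≡⟨ det-⊗ W⁻¹ W ⟨
    det (W⁻¹ ⊗ W)    ≈⟨ det-cong-mod p-1 W⁻¹⊗W ⟩
    det {p-1} 𝟙      ≡⟨ det-𝟙 p-1 ⟩
    1ℤ               ∎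

  -- The determinant of D and the three cases.

  module Determinant (c : ℤ) where

    open Eigenvalues c

    row-factor : Fin p-1 → ℤ
    row-factor i = x i ^ (k ℕ.+ k)

    D⊗W : ∀ i r → (D p c ⊗ W) i r ≈ row-factor i * (W i r * μ (toℕ r))
    D⊗W i r = ≈-trans (≡⇒≈ (sym (∑ₚˣ-Fin (λ y → entry (x i) y * y ^ ℕ.suc (toℕ r))))) (eigenvector (toℕ r) (x≉0 i))

    det-D-product : det (D p c) ≈ ∏ row-factor * ∏< p-1 μ
    det-D-product = begin
      det (D p c)                                            ≡⟨ *-identityʳ (det (D p c)) ⟨
      det (D p c) * 1ℤ                                       ≈⟨ *-congˡ (det (D p c)) det-W-invertible ⟨
      det (D p c) * (det W⁻¹ * det W)                        ≡⟨ regroup (det (D p c)) (det W⁻¹) (det W) ⟩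
      det (D p c) * det W * det W⁻¹                          ≡⟨ cong (_* det W⁻¹) (det-⊗ (D p c) W) ⟨
      det (D p c ⊗ W) * det W⁻¹                              ≈⟨ *-congʳ (det W⁻¹) (det-cong-mod p-1 D⊗W) ⟩
      det (λ i r → row-factor i * (W i r * μ (toℕ r))) * det W⁻¹
        ≡⟨ cong (_* det W⁻¹) (trans (det-scale-rows p-1 row-factor (λ i r → W i r * μ (toℕ r)))
             (cong (∏ row-factor *_) (det-scale-columns p-1 W (λ r → μ (toℕ r))))) ⟩
      ∏ row-factor * (det W * ∏< p-1 μ) * det W⁻¹            ≡⟨ collect (∏ row-factor) (det W) (∏< p-1 μ) (det W⁻¹) ⟩
      ∏ row-factor * ∏< p-1 μ * (det W⁻¹ * det W)            ≈⟨ *-congˡ (∏ row-factor * ∏< p-1 μ) det-W-invertible ⟩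
      ∏ row-factor * ∏< p-1 μ * 1ℤ                           ≡⟨ *-identityʳ _ ⟩
      ∏ row-factor * ∏< p-1 μ                                ∎
      where
      regroup : ∀ d z w → d * (z * w) ≡ d * w * z
      regroup = solve-∀
      collect : ∀ e w l z → e * (w * l) * z ≡ e * l * (z * w)
      collect = solve-∀

    det-D : ∃[ y ] det (D p c) ≈ y * y * (μ 0 * μ m)
    det-D = Y * z , (begin
      det (D p c)                                   ≈⟨ det-D-product ⟩
      ∏ row-factor * (μ 0 * ∏< n (λ i → μ (ℕ.suc i)))
        ≈⟨ *-cong (≡⇒≈ row-square) (*-congˡ (μ 0) ∏μ≈) ⟩
      Y * Y * (μ 0 * (μ m * (z * z)))               ≡⟨ regroup Y z (μ 0) (μ m) ⟩
      Y * z * (Y * z) * (μ 0 * μ m)                 ∎)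
      where
      -- The row factors have the even exponent 2k = p - 3, so their product is a square.
      Y = ∏ {p-1} (λ i → x i ^ k)
      row-square : ∏ row-factor ≡ Y * Y
      row-square = trans (Prod.sum-cong-≗ {p-1} (λ i → ^-distribˡ-+-* (x i) k k))
                         (Prod.∑-distrib-+ {p-1} (λ i → x i ^ k) (λ i → x i ^ k))
      shifted : ∀ {i j} → i ℕ.+ j ≡ k ℕ.+ k → ℕ.suc i ℕ.+ ℕ.suc j ≡ p-1
      shifted {i} {j} eq = cong ℕ.suc (trans (ℕ.+-suc i j) (cong ℕ.suc eq))
      -- The mirror image of μ₀ would have index p - 1, out of range, so μ₀ is set aside; the
      -- remaining indices 1 to p - 2 are symmetric about m = k + 1.
      inner = ∏<-palindrome k (λ i → μ (ℕ.suc i)) (λ i j eq → μ-symmetric (ℕ.suc i) (ℕ.suc j) (shifted eq))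
      z = proj₁ inner
      ∏μ≈ = proj₂ inner
      regroup : ∀ y z a b → y * y * (a * (b * (z * z))) ≡ y * z * (y * z) * (a * b)
      regroup = solve-∀

    -- `b` is the argument -c - 2 of the symbol in the conclusions, and `A` is the discriminant,
    -- equal to the product of `a` and `b`.
    A a b : ℤ
    A = c * c - + 4
    a = + 2 - c
    b = - + 2 - c

    det-D-singular : k ≢ 0 → A ≈ 0ℤ → det (D p c) ≈ 0ℤ
    det-D-singular k≢0 A≈0 = begin
      det (D p c)              ≈⟨ proj₂ det-D ⟩
      y * y * (μ 0 * μ m)      ≈⟨ *-congˡ (y * y) (*-congʳ (μ m) μ₀≈0) ⟩
      y * y * (0ℤ * μ m)       ≡⟨ vanish y (μ m) ⟩
      0ℤ                       ∎
      where
      y = proj₁ det-D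
      vanish : ∀ y u → y * y * (0ℤ * u) ≡ 0ℤ
      vanish = solve-∀
      -- This is where p ≠ 3 enters: for k = 0 the power would be 1.
      A^k≈0 : A ^ k ≈ 0ℤ
      A^k≈0 = ≈-trans (≡⇒≈ (cong (A ^_) (sym (ℕ.suc-pred k {{ℕ.≢-nonZero k≢0}})))) (0^suc (ℕ.pred k) A≈0)
      μ₀≈0 : μ 0 ≈ 0ℤ
      μ₀≈0 = ≈-trans μ₀ (≈-trans (-‿cong (*-congˡ c A^k≈0)) (≡⇒≈ (cong -_ (*-zeroʳ c))))

    A≡ab : A ≡ a * b
    A≡ab = factor c
      where
      factor : ∀ c → c * c - + 4 ≡ (+ 2 - c) * (- + 2 - c)
      factor = solve-∀

    -- Multiplying by A² = A · ab turns the exponents k of μ₀ and μₘ into m = k + 1.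
    A²μ₀μₘ : A * A * (μ 0 * μ m) ≈ + m * c * A ^ m * (b * a ^ m + a * b ^ m)
    A²μ₀μₘ = begin
      A * A * (μ 0 * μ m)
        ≈⟨ *-congˡ (A * A) (*-cong μ₀ μₘ) ⟩
      A * A * (- (c * A ^ k) * - (+ m * (a ^ k + b ^ k)))
        ≡⟨ cong (λ z → z * A * (- (c * A ^ k) * - (+ m * (a ^ k + b ^ k)))) A≡ab ⟩
      a * b * A * (- (c * A ^ k) * - (+ m * (a ^ k + b ^ k)))
        ≡⟨ regroup a b A c (A ^ k) (+ m) (a ^ k) (b ^ k) ⟩
      + m * c * A ^ m * (b * a ^ m + a * b ^ m) ∎
      where
      regroup : ∀ a b A c X m u v → a * b * A * (- (c * X) * - (m * (u + v))) ≡ m * c * (A * X) * (b * (a * u) + a * (b * v))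
      regroup = solve-∀

    -- Here ε is the symbol of c² - 4. From (ab)ᵐ ≈ ε follows aᵐ ≈ ε bᵐ, so bᵐ, the symbol of -c -
    -- 2, factors out of b aᵐ + a bᵐ.
    det-D-regular : ∀ {ε} → ε * ε ≡ 1ℤ → A ^ m ≈ ε →
                    ∃[ y ] det (D p c) ≈ y * y * (+ m * c * (b + ε * a) * b ^ m)
    -- Dividing y by A makes up for the factor A² in `A²μ₀μₘ`.
    det-D-regular {ε} εε≡1 A^m≈ε = y * inv A , (begin
      det (D p c)                                        ≈⟨ proj₂ det-D ⟩
      y * y * (μ 0 * μ m)                                ≡⟨ cong (_* (μ 0 * μ m)) (*-identityʳ (y * y)) ⟨
      y * y * 1ℤ * (μ 0 * μ m)                           ≈⟨ *-congʳ (μ 0 * μ m) (*-congˡ (y * y) (*-cong (*-inv A≉0) (*-inv A≉0))) ⟨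
      y * y * (A * inv A * (A * inv A)) * (μ 0 * μ m)    ≡⟨ regroup y A (inv A) (μ 0 * μ m) ⟩
      y * inv A * (y * inv A) * (A * A * (μ 0 * μ m))    ≈⟨ *-congˡ (y * inv A * (y * inv A)) reduce ⟩
      y * inv A * (y * inv A) * (+ m * c * (b + ε * a) * b ^ m) ∎)
      where
      y = proj₁ det-D
      regroup : ∀ y A i u → y * y * (A * i * (A * i)) * u ≡ y * i * (y * i) * (A * A * u)
      regroup = solve-∀
      ε≉0 : ε ≉ 0ℤ
      ε≉0 ε≈0 = 1≉0 (≈-trans (≡⇒≈ (sym εε≡1)) (*-congʳ ε ε≈0))
      A≉0 : A ≉ 0ℤ
      A≉0 A≈0 = ε≉0 (≈-trans (≈-sym A^m≈ε) (0^suc k A≈0))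
      b≉0 : b ≉ 0ℤ
      b≉0 b≈0 = A≉0 (≈-trans (≡⇒≈ A≡ab) (≈-trans (*-congˡ a b≈0) (≡⇒≈ (*-zeroʳ a))))
      a^m≈ : a ^ m ≈ ε * b ^ m
      a^m≈ = begin
        a ^ m                      ≡⟨ *-identityʳ (a ^ m) ⟨
        a ^ m * 1ℤ                 ≈⟨ *-congˡ (a ^ m) (fermat-half b≉0) ⟨
        a ^ m * (b ^ m * b ^ m)    ≡⟨ *-assoc (a ^ m) (b ^ m) (b ^ m) ⟨
        a ^ m * b ^ m * b ^ m      ≡⟨ cong (_* b ^ m) (^-distribʳ-* m a b) ⟨
        (a * b) ^ m * b ^ m        ≡⟨ cong (λ z → z ^ m * b ^ m) A≡ab ⟨
        A ^ m * b ^ m              ≈⟨ *-congʳ (b ^ m) A^m≈ε ⟩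
        ε * b ^ m                  ∎
      expand : ∀ m c ε b a β → m * c * ε * (b * (ε * β) + a * β) ≡ m * c * (ε * ε * b + ε * a) * β
      expand = solve-∀
      reduce : A * A * (μ 0 * μ m) ≈ + m * c * (b + ε * a) * b ^ m
      reduce = begin
        A * A * (μ 0 * μ m)                                   ≈⟨ A²μ₀μₘ ⟩
        + m * c * A ^ m * (b * a ^ m + a * b ^ m)
          ≈⟨ *-cong (*-congˡ (+ m * c) A^m≈ε) (+-congʳ (a * b ^ m) (*-congˡ b a^m≈)) ⟩
        + m * c * ε * (b * (ε * b ^ m) + a * b ^ m)           ≡⟨ expand (+ m) c ε b a (b ^ m) ⟩
        + m * c * (ε * ε * b + ε * a) * b ^ m
          ≡⟨ cong (λ z → + m * c * (z + ε * a) * b ^ m) (trans (cong (_* b) εε≡1) (*-identityˡ b)) ⟩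
        + m * c * (b + ε * a) * b ^ m                         ∎

    legendre-discriminant : ∀ {ε} → legendre (c ^ 2 - + 4) p ≡ ε → A ^ m ≈ ε
    legendre-discriminant leg≡ε = ≈-trans (≡⇒≈ (cong (λ z → (z - + 4) ^ m) (cong (c *_) (sym (*-identityʳ c)))))
      (≈-trans (≈-sym (euler-criterion (c ^ 2 - + 4))) (≡⇒≈ leg≡ε))

    b^m≈legendre : b ^ m ≈ legendre (- c - + 2) p
    b^m≈legendre = ≈-trans (≡⇒≈ (cong (_^ m) (+-comm (- + 2) (- c)))) (≈-sym (euler-criterion (- c - + 2)))

    part₁ : k ≢ 0 → c ≡ + 2 [mod p ] ⊎ c ≡ - (+ 2) [mod p ] → + p ∣ det (D p c)
    part₁ k≢0 c≡±2 = subst (+ p ∣_) (+-identityʳ (det (D p c)))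
      (difference (det-D-singular k≢0 ([ square (+ 2) refl , square (- + 2) refl ]′ c≡±2)))
      where
      square : ∀ e → e * e ≡ + 4 → c ≡ e [mod p ] → A ≈ 0ℤ
      square e ee≡4 c≡e = ≈-trans (+-congʳ (- + 4) (*-cong {c} {e} {c} {e} ⟨ c≡e ⟩ ⟨ c≡e ⟩)) (≡⇒≈ (cong (_- + 4) ee≡4))

    part₂ : legendre (c ^ 2 - + 4) p ≡ 1ℤ → ∃[ y ] det (D p c) ≡ y ^ 2 * legendre (- c - + 2) p [mod p ]
    -- For ε = 1, b + a = -2c and m c (-2c) ≈ c², so c joins the witness.
    part₂ leg≡1 = y * c , difference (begin
      det (D p c)                                            ≈⟨ proj₂ regular ⟩
      y * y * (+ m * c * (b + 1ℤ * a) * b ^ m)               ≡⟨ regroup y (+ m) c (b ^ m) ⟩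
      (+ m + + m) * (y * y * (- c * c * b ^ m))              ≈⟨ *-congʳ (y * y * (- c * c * b ^ m)) 2m≈-1 ⟩
      -1ℤ * (y * y * (- c * c * b ^ m))                      ≡⟨ collect y c (b ^ m) ⟩
      (y * c) ^ 2 * b ^ m                                    ≈⟨ *-congˡ ((y * c) ^ 2) b^m≈legendre ⟩
      (y * c) ^ 2 * legendre (- c - + 2) p                   ∎)
      where
      regular = det-D-regular refl (legendre-discriminant leg≡1)
      y = proj₁ regular
      regroup : ∀ y m c β → y * y * (m * c * (- + 2 - c + 1ℤ * (+ 2 - c)) * β) ≡ (m + m) * (y * y * (- c * c * β))
      regroup = solve-∀
      collect : ∀ y c β → -1ℤ * (y * y * (- c * c * β)) ≡ y * c * (y * c * 1ℤ) * β
      collect = solve-∀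

    part₃ : legendre (c ^ 2 - + 4) p ≡ -1ℤ → ∃[ y ] det (D p c) ≡ + 2 * c * y ^ 2 * legendre (- c - + 2) p [mod p ]
    -- For ε = -1, b - a = -4 and m c (-4) ≈ 2c, so a single c stays outside the square.
    part₃ leg≡-1 = y , difference (begin
      det (D p c)                                            ≈⟨ proj₂ regular ⟩
      y * y * (+ m * c * (b + -1ℤ * a) * b ^ m)              ≡⟨ regroup y (+ m) c (b ^ m) ⟩
      (+ m + + m) * (y * y * (- + 2 * c * b ^ m))            ≈⟨ *-congʳ (y * y * (- + 2 * c * b ^ m)) 2m≈-1 ⟩
      -1ℤ * (y * y * (- + 2 * c * b ^ m))                    ≡⟨ collect y c (b ^ m) ⟩
      + 2 * c * y ^ 2 * b ^ m                                ≈⟨ *-congˡ (+ 2 * c * y ^ 2) b^m≈legendre ⟩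
      + 2 * c * y ^ 2 * legendre (- c - + 2) p               ∎)
      where
      regular = det-D-regular refl (legendre-discriminant leg≡-1)
      y = proj₁ regular
      regroup : ∀ y m c β → y * y * (m * c * (- + 2 - c + -1ℤ * (+ 2 - c)) * β) ≡ (m + m) * (y * y * (- + 2 * c * β))
      regroup = solve-∀
      collect : ∀ y c β → -1ℤ * (y * y * (- + 2 * c * β)) ≡ + 2 * c * (y * (y * 1ℤ)) * β
      collect = solve-∀

odd≥3 : ∀ {p} → Prime p → 2 ∤ p → ∃[ k ] p ≡ 3 ℕ.+ (k ℕ.+ k)
odd≥3 {p} p-prime 2∤p with parity p
  where
  parity : ∀ n → ∃[ k ] (n ≡ k ℕ.+ k ⊎ n ≡ ℕ.suc (k ℕ.+ k))
  parity ℕ.zero    = 0 , inj₁ refl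
  parity (ℕ.suc n) with parity n
  ... | k , inj₁ n≡2k   = k , inj₂ (cong ℕ.suc n≡2k)
  ... | k , inj₂ n≡1+2k = ℕ.suc k , inj₁ (cong ℕ.suc (trans n≡1+2k (sym (ℕ.+-suc k k))))
... | k , inj₁ refl = contradiction (ℕ.divides k (trans (cong (k ℕ.+_) (sym (ℕ.+-identityʳ k))) (ℕ.*-comm 2 k))) 2∤p
... | ℕ.zero  , inj₂ refl = contradiction p-prime ¬prime[1]
... | ℕ.suc k , inj₂ refl = k , cong (λ x → 2 ℕ.+ x) (ℕ.+-suc k k)

theorem1p1 : (p : ℕ) → Prime p → 2 ∤ p → (c : ℤ) →
    (p ≢ 3 → c ≡ + 2 [mod p ] ⊎ c ≡ - (+ 2) [mod p ] → + p ∣ det (D p c))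
    × (legendre (c ^ 2 - + 4) p ≡ 1ℤ →
    ∃[ x ] det (D p c) ≡ x ^ 2 * legendre (- c - + 2) p [mod p ])
    × (legendre (c ^ 2 - + 4) p ≡ -1ℤ →
    ∃[ x ] det (D p c) ≡ + 2 * c * x ^ 2 * legendre (- c - + 2) p [mod p ])
theorem1p1 p p-prime 2∤p c with odd≥3 p-prime 2∤p
... | k , refl = (λ p≢3 → part₁ λ { refl → p≢3 refl }) , part₂ , part₃
  where
  open OddPrime k p-prime
  open Determinant c
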